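{- Consider the field extension $\mathbb{F}_q \subsetneq \mathbb{F}_{q^{m}}$, where $q$ is a prime power and $m$ is a composite number. Let $t$ be the smallest prime divisor of $m$, and let $n$ be an integer with $t \le n < m$. Then there exist $\mathbb{F}_q$-subspaces $A,B \subseteq \mathbb{F}_{q^{m}}$ with $\dim A=\dim B=n$ and $1\notin B$ such that the pair $(A,B)$ is unmatchable (with respect to the extension $\mathbb{F}_q \subsetneq \mathbb{F}_{q^{m}}$) if and only if there exists a positive divisor $d$ of $m$ such that $d \leq n$ and $d\nmid (n+1)$.
   Context: Let $K\subsetneq L$ be a field extension and let $A,B$ be $n$-dimensional $K$-subspaces of $L$ with $n>0$. For a subset $X$ of $L$, $\langle X\rangle$ denotes the $K$-subspace of $L$ spanned by $X$. An ordered basis $\{a_1,\ldots,a_n\}$ of $A$ is matched to an ordered basis $\{b_1,\ldots,b_n\}$ of $B$ if, for each $i\in\{1,\ldots,n\}$, $a_i^{ -1}A\cap B\subseteq \langle b_1,\ldots,b_{i-1},b_{i+1},\ldots,b_n\rangle$. The subspace $A$ is matched to $B$ (equivalently, the pair $(A,B)$ is matchable) if every ordered basis of $A$ can be matched to some ordered basis of $B$; otherwise $(A,B)$ is unmatchable. Here $K=\mathbb{F}_q$, $L=\mathbb{F}_{q^m}$, and dimensions are over $\mathbb{F}_q$. -}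

module Defs where

open import Algebra.Apartness.Bundles using (HeytingField; HeytingCommutativeRing)
open import Algebra.Bundles using (CommutativeRing)
open import Algebra.Morphism.Structures using (IsRingMonomorphism)
import Algebra.Properties.Monoid.Sum as MonoidSum
open import Data.Fin.Base using (Fin)
open import Data.Nat.Base using (ℕ; _≤_; _^_)
open import Data.Nat.Divisibility using (_∣_)
open import Data.Nat.Primality using (Prime)
open import Data.Product.Base using (∃-syntax; _×_)
open import Data.Vec.Functional using (Vector)
open import Function.Bundles using (Inverse)
open import Function.Definitions using (Surjective)
open import Level using (Level; _⊔_; suc)
open import Relation.Binary.PropositionalEquality using (_≡_; _≢_; setoid)
open import Relation.Nullary.Negation using (¬_)
open import Relation.Unary using (Pred; _∈_; _⊆_; _∩_; _≐_)

PrimePower : ℕ → Set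
PrimePower q = ∃[ p ] ∃[ k ] Prime p × 1 ≤ k × q ≡ p ^ k

SmallestPrimeDivisor : ℕ → ℕ → Set
SmallestPrimeDivisor t m =
  Prime t × t ∣ m × (∀ p → Prime p → p ∣ m → t ≤ p)

-- A Heyting field is automatically nontrivial: if 1# ≈ 0#, then 0# is
-- invertible, hence 0# # 0#, contradicting irreflexivity.  When its carrier
-- is finite, _≈_ is decidable and _#_ is equivalent to the negation of _≈_,
-- so finite Heyting fields are exactly the finite fields.

ringOf : ∀ {c ℓ₁ ℓ₂} → HeytingField c ℓ₁ ℓ₂ → CommutativeRing c ℓ₁
ringOf F = HeytingCommutativeRing.commutativeRing (HeytingField.heytingCommutativeRing F)

HasCardinality : ∀ {c ℓ₁ ℓ₂} → HeytingField c ℓ₁ ℓ₂ → ℕ → Set (c ⊔ ℓ₁)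
HasCardinality F n = Inverse (CommutativeRing.setoid (ringOf F)) (setoid (Fin n))

record ProperFieldExtension {c ℓ₁ ℓ₂ c′ ℓ₁′ ℓ₂′ : Level}
         (K : HeytingField c ℓ₁ ℓ₂) (L : HeytingField c′ ℓ₁′ ℓ₂′) :
         Set (c ⊔ ℓ₁ ⊔ c′ ⊔ ℓ₁′) where
  private
    module K = HeytingField K
    module L = HeytingField L
  field
    embed              : K.Carrier → L.Carrier
    isRingMonomorphism : IsRingMonomorphism
                           (CommutativeRing.rawRing (ringOf K))
                           (CommutativeRing.rawRing (ringOf L)) embed
    proper             : ¬ Surjective K._≈_ L._≈_ embed

module LinearMatching
  {c ℓ₁ ℓ₂ c′ ℓ₁′ ℓ₂′ : Level}
  {K : HeytingField c ℓ₁ ℓ₂} {L : HeytingField c′ ℓ₁′ ℓ₂′}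
  (E : ProperFieldExtension K L)
  where

  private
    module K = HeytingField K
  open CommutativeRing (ringOf L)
    using (Carrier; _≈_; _+_; _*_; 0#; 1#; +-monoid)
  open MonoidSum +-monoid using (sum)
  open ProperFieldExtension E using (embed)

  infixr 7 _·_
  _·_ : K.Carrier → Carrier → Carrier
  k · x = embed k * x

  record Subspace (p : Level) : Set (c ⊔ c′ ⊔ ℓ₁′ ⊔ suc p) where
    field
      member   : Pred Carrier p
      resp-≈   : ∀ {x y} → x ≈ y → x ∈ member → y ∈ member
      0-closed : 0# ∈ member
      +-closed : ∀ {x y} → x ∈ member → y ∈ member → x + y ∈ member
      ·-closed : ∀ k {x} → x ∈ member → k · x ∈ member

  open Subspace public using (member)

  linearCombination : ∀ {n} → Vector K.Carrier n → Vector Carrier n → Carrier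
  linearCombination k v = sum (λ i → k i · v i)

  ⟨_⟩ : ∀ {p} → Pred Carrier p → Pred Carrier (c ⊔ c′ ⊔ ℓ₁′ ⊔ p)
  ⟨ X ⟩ x = ∃[ n ] ∃[ v ] ∃[ k ]
    (∀ (i : Fin n) → v i ∈ X) × x ≈ linearCombination k v

  LinearlyIndependent : ∀ {n} → Vector Carrier n → Set (c ⊔ ℓ₁ ⊔ ℓ₁′)
  LinearlyIndependent v =
    ∀ k → linearCombination k v ≈ 0# → ∀ i → k i K.≈ K.0#

  entries : ∀ {n} → Vector Carrier n → Pred Carrier ℓ₁′
  entries v x = ∃[ i ] x ≈ v i

  entriesExcept : ∀ {n} → Fin n → Vector Carrier n → Pred Carrier ℓ₁′
  entriesExcept i v x = ∃[ j ] j ≢ i × x ≈ v j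

  IsOrderedBasis : ∀ {p n} → Vector Carrier n → Subspace p →
                   Set (c ⊔ ℓ₁ ⊔ c′ ⊔ ℓ₁′ ⊔ p)
  IsOrderedBasis v V = LinearlyIndependent v × ⟨ entries v ⟩ ≐ member V

  HasDimension : ∀ {p} → Subspace p → ℕ → Set (c ⊔ ℓ₁ ⊔ c′ ⊔ ℓ₁′ ⊔ p)
  HasDimension V n = ∃[ v ] IsOrderedBasis {n = n} v V

  -- The set a⁻¹X.  It is only used for a ranging over basis vectors; these are
  -- nonzero, so an inverse a⁻¹ exists and is unique up to _≈_.
  infixr 7 _⁻¹∙_
  _⁻¹∙_ : ∀ {p} → Carrier → Pred Carrier p → Pred Carrier (c′ ⊔ ℓ₁′ ⊔ p)
  (a ⁻¹∙ X) x = ∃[ a⁻¹ ] a⁻¹ * a ≈ 1# × (∃[ y ] y ∈ X × x ≈ a⁻¹ * y)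

  BasisMatched : ∀ {p n} → Subspace p → Subspace p →
                 Vector Carrier n → Vector Carrier n → Set (c ⊔ c′ ⊔ ℓ₁′ ⊔ p)
  BasisMatched A B a b =
    ∀ i → ((a i ⁻¹∙ member A) ∩ member B) ⊆ ⟨ entriesExcept i b ⟩

  -- Here n is the common dimension of A and B.
  Matchable : ∀ {p} → ℕ → Subspace p → Subspace p → Set (c ⊔ ℓ₁ ⊔ c′ ⊔ ℓ₁′ ⊔ p)
  Matchable n A B =
    ∀ (a : Vector Carrier n) → IsOrderedBasis a A →
    ∃[ b ] IsOrderedBasis {n = n} b B × BasisMatched A B a b

  Unmatchable : ∀ {p} → ℕ → Subspace p → Subspace p → Set (c ⊔ ℓ₁ ⊔ c′ ⊔ ℓ₁′ ⊔ p)
  Unmatchable n A B = ¬ Matchable n A B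

{-# OPTIONS --safe #-}

-- If 1 ∉ B and (A , B) is unmatchable, Rado's theorem, applied to the subspaces
-- W i = (a i)⁻¹A ∩ B, gives a set J of basis vectors such that S = ⟨a j : j ∈ J⟩ and
-- T = K ⊕ ⋂ W j satisfy ST ⊆ A and dim S + dim T ≥ n + 2.  Dyson transforms preserve
-- these properties and end with TS ⊆ S, so T lies in the subfield H = {x : xS ⊆ S}.
-- Its degree h divides dim S, and n + 2 - h ≤ dim S ≤ n rules out h ∣ n + 1.
--
-- Conversely let H be the subfield of degree d and write n = kd + r, so that r < d - 1.
-- Take A ⊇ U for an H-subspace U of K-dimension kd, and B ∌ 1 containing a hyperplane of
-- H.  That hyperplane lies in u⁻¹A ∩ B for each nonzero u ∈ U, so if a basis of A extending
-- one of U were matched, it would lie in the span of r basis vectors.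
module Submission where

open import Defs
import Level
open import Algebra.Apartness.Bundles using (HeytingField)
open import Algebra.Bundles using (CommutativeRing)
open import Algebra.Morphism.Structures using (IsRingMonomorphism)
import Algebra.Properties.CommutativeMonoid.Sum as CommutativeMonoidSum
import Algebra.Properties.CommutativeSemiring.Binomial as Binomial
import Algebra.Properties.CommutativeSemiring.Exp as CommutativeExp
import Algebra.Properties.Monoid.Mult as Mult
import Algebra.Properties.Ring as RingProperties
import Algebra.Properties.Semiring.Exp as Exp
import Algebra.Properties.Semiring.Mult as SemiringMult
open import Data.Fin.Base using (Fin; zero; suc; combine; finToFun; fromℕ; funToFin; inject₁; punchIn; punchOut; _↑ˡ_; _↑ʳ_)
open import Data.Fin.Permutation using (Permutation′; permutation)
import Data.Fin.Properties as Fin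
open import Data.Fin.Subset as Subset using (Subset; inside; outside; ∣_∣; ∁; ⁅_⁆; _∪_) renaming (_∈_ to _∈ˢ_; _∩_ to _∩ˢ_; ⊤ to ⊤ˢ)
import Data.Fin.Subset.Properties as Subset
open import Data.List.Base using (List; []; _∷_; allFin)
open import Data.List.Membership.Propositional.Properties using (∈-allFin)
import Data.List.Relation.Unary.All as ListAll
open import Data.Maybe.Base using (nothing)
open import Data.Nat.Base as ℕ using (ℕ; zero; suc; _≤_; _<_; z≤n; s≤s; _!)
open import Data.Nat.Combinatorics using (_C_; nCn≡1; nCk≡n!/k![n-k]!; k![n∸k]!∣n!)
open import Data.Nat.Divisibility using (_∣_; _∤_; _∣?_; divides; m∣m*n; ∣⇒≤)
open import Data.Nat.DivMod using (_/_; _%_; m/n*n≡m; m≡m%n+[m/n]*n; m%n<n)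
open import Data.Nat.Primality using (Composite; Prime; euclidsLemma; prime⇒nonTrivial; prime⇒nonZero)
import Data.Nat.Properties as ℕ
open import Data.Nat.Tactic.RingSolver using () renaming (solve-∀ to ℕ-solve)
open import Data.Product.Base using (∃-syntax; Σ-syntax; _×_; _,_; proj₁; proj₂)
open import Data.Sum.Base using (_⊎_; inj₁; inj₂)
open import Data.Unit.Base using (⊤)
open import Data.Vec.Base using (Vec; []; _∷_; here; there; lookup; map; tabulate) renaming (_++_ to _⧺_)
open import Data.Vec.Functional using (Vector; insertAt; removeAt; replicate; updateAt) renaming (_∷_ to _◂_)
open import Data.Vec.Functional.Properties using (insertAt-lookup; insertAt-punchIn; updateAt-updates; updateAt-minimal)
import Data.Vec.Properties as Vec
open import Data.Vec.Relation.Unary.All as All using (All; []; _∷_)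
open import Function.Base using (_∘_)
open import Function.Bundles using (Inverse; _⇔_; mk⇔)
open import Level using (Level; _⊔_)
open import Relation.Binary.PropositionalEquality as ≡ using (_≡_; _≢_)
import Relation.Binary.Reasoning.Setoid as SetoidReasoning
open import Relation.Nullary.Decidable.Core using (Dec; yes; no; map′; decidable-stable; ¬?; _×-dec_; _→-dec_)
open import Relation.Nullary.Negation using (¬_; contradiction)
open import Relation.Unary using (Pred; Decidable; _∈_; _∉_; _⊆_; _∩_; _≐_)
open import Tactic.RingSolver using (solve-∀)
open import Tactic.RingSolver.Core.AlmostCommutativeRing using (AlmostCommutativeRing; fromCommutativeRing)

-- Finite fields

-- Rado's theorem is used in dual form. Each W i is enlarged to a hyperplane of B without breaking
-- |J| + dim ⋂ W j ≤ n; n such hyperplanes meet only in 0, and the matched basis is the one dual to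
-- the functionals that cut them out. Failure of that inequality gives n + 1; the bound n + 2 comes
-- from 1 ∉ B, which makes the sum K ⊕ ⋂ W j direct. In the converse, 1 ∉ B costs a dimension: only
-- a hyperplane of H fits into B, so d - 1 has to exceed the remainder r, and this fails exactly
-- when r = d - 1, that is, when d divides n + 1. The fields are known only through their
-- cardinalities, so the subfield of degree d has to be constructed. It is the fixed field of x ↦
-- x^(q^d): counting roots bounds its dimension above by d, and the trace into it, whose kernel is
-- again bounded by counting roots, bounds it below. Counting also replaces the exchange argument of
-- linear algebra, since n independent vectors have q^n combinations.

module FiniteField {c ℓ₁ ℓ₂} (F : HeytingField c ℓ₁ ℓ₂) {N : ℕ} (card : HasCardinality F N) where

  private module F = HeytingField F
  open CommutativeRing (ringOf F) hiding (zero)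
  open RingProperties ring
  open Exp semiring
  open Inverse card using (to; from; to-cong; strictlyInverseˡ; strictlyInverseʳ)
  open SetoidReasoning setoid
  private
    module ∑ = CommutativeMonoidSum +-commutativeMonoid
    module ∏ = CommutativeMonoidSum *-commutativeMonoid
  open Mult +-monoid using () renaming (_×_ to _×#_)

  infix 4 _≟_
  _≟_ : ∀ x y → Dec (x ≈ y)
  x ≟ y = map′ (λ eq → trans (sym (strictlyInverseʳ x)) (trans (reflexive (≡.cong from eq)) (strictlyInverseʳ y)))
               to-cong (to x Fin.≟ to y)

  search : ∀ {p} {P : Pred Carrier p} → (∀ {x y} → x ≈ y → P x → P y) → Decidable P → Dec (∃[ x ] P x)
  search resp P? = map′ (λ (i , Pi) → from i , Pi) (λ (x , Px) → to x , resp (sym (strictlyInverseʳ x)) Px)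
                        (Fin.any? (P? ∘ from))

  1≉0 : ¬ 1# ≈ 0#
  1≉0 1≈0 = F.#-irrefl refl 0#0
    where
    0#0 : 0# F.# 0#
    0#0 = F.invertible⇒# (0# , trans (zeroˡ _) (sym 1≈0) , trans (zeroʳ _) (sym 1≈0))

  -- Tightness only yields ¬ ¬ (x # 0#); finiteness makes invertibility decidable.
  inverse : ∀ {x} → ¬ x ≈ 0# → ∃[ y ] y * x ≈ 1#
  inverse {x} x≉0 = decidable-stable
    (search (λ y≈z yx≈1 → trans (*-congʳ (sym y≈z)) yx≈1) (λ y → y * x ≟ 1#))
    λ ¬inv → x≉0 (proj₁ (F.tight _ _) λ x#0 →
      let y , yx≈1 , _ = F.#⇒invertible x#0 in ¬inv (y , trans (*-congˡ (sym x-0≈x)) yx≈1))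
    where
    x-0≈x : x - 0# ≈ x
    x-0≈x = trans (+-congˡ -0#≈0#) (+-identityʳ x)

  cancel-≉0 : ∀ {x y} → ¬ x ≈ 0# → x * y ≈ 0# → y ≈ 0#
  cancel-≉0 {x} {y} x≉0 xy≈0 = let z , zx≈1 = inverse x≉0 in begin
    y            ≈⟨ *-identityˡ y ⟨
    1# * y       ≈⟨ *-congʳ zx≈1 ⟨
    z * x * y    ≈⟨ *-assoc z x y ⟩
    z * (x * y)  ≈⟨ *-congˡ xy≈0 ⟩
    z * 0#       ≈⟨ zeroʳ z ⟩
    0#           ∎

  private
    translation : ∀ (f g : Carrier → Carrier) → (∀ {x y} → x ≈ y → f x ≈ f y) → (∀ {x y} → x ≈ y → g x ≈ g y) →
                  (∀ x → f (g x) ≈ x) → (∀ x → g (f x) ≈ x) → Permutation′ N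
    translation f g f-cong g-cong fg gf = permutation (to ∘ f ∘ from) (to ∘ g ∘ from)
      (inv f g f-cong fg) (inv g f g-cong gf)
      where
      inv : ∀ (f g : Carrier → Carrier) → (∀ {x y} → x ≈ y → f x ≈ f y) → (∀ x → f (g x) ≈ x) →
            ∀ i → to (f (from (to (g (from i))))) ≡ i
      inv f g f-cong fg i = ≡.trans (to-cong (trans (f-cong (strictlyInverseʳ _)) (fg _))) (strictlyInverseˡ i)

  -- Translation by 1# permutes the field, so the sum of all elements does not change when 1# is
  -- added to each of its N terms.
  card×1≈0 : N ×# 1# ≈ 0#
  card×1≈0 = +-identityʳ-unique _ _ (begin
    ∑.sum from + N ×# 1#                   ≈⟨ +-congˡ (∑.sum-replicate N) ⟨
    ∑.sum from + ∑.sum (replicate N 1#)    ≈⟨ ∑.∑-distrib-+ from _ ⟨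
    ∑.sum (λ i → from i + 1#)              ≈⟨ ∑.sum-cong-≋ {N} (λ i → strictlyInverseʳ (from i + 1#)) ⟨
    ∑.sum (λ i → from (to (from i + 1#)))  ≈⟨ ∑.sum-permute from shift ⟨
    ∑.sum from                             ∎)
    where
    shift = translation (_+ 1#) (_- 1#) +-congʳ +-congʳ
      (λ x → trans (+-assoc x _ _) (trans (+-congˡ (-‿inverseˡ 1#)) (+-identityʳ x)))
      (λ x → trans (+-assoc x _ _) (trans (+-congˡ (-‿inverseʳ 1#)) (+-identityʳ x)))

  private
    -- The position i is the index of 0#, where `fermat` puts 1# in place of x. The extra factor x
    -- makes up for it, so the exponent is n rather than n - 1.
    *∏≈^ : ∀ {n} (i : Fin n) (f : Vector Carrier n) x → f i ≈ 1# → (∀ j → j ≢ i → f j ≈ x) → x * ∏.sum f ≈ x ^ n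
    *∏≈^ {suc n} i f x fi≈1 f≈x = *-congˡ (begin
      ∏.sum f                      ≈⟨ ∏.sum-remove {i = i} f ⟩
      f i * ∏.sum (removeAt f i)   ≈⟨ *-congʳ fi≈1 ⟩
      1# * ∏.sum (removeAt f i)    ≈⟨ *-identityˡ _ ⟩
      ∏.sum (removeAt f i)         ≈⟨ ∏.sum-cong-≋ (λ j → f≈x (punchIn i j) (Fin.punchInᵢ≢i i j)) ⟩
      ∏.sum (replicate n x)        ≈⟨ ∏.sum-replicate n ⟩
      x ^ n                        ∎)

    ∏≉0 : ∀ {n} (f : Vector Carrier n) → (∀ i → ¬ f i ≈ 0#) → ¬ ∏.sum f ≈ 0#
    ∏≉0 {zero}  f f≉0 = 1≉0
    ∏≉0 {suc n} f f≉0 = ∏≉0 (f ∘ suc) (f≉0 ∘ suc) ∘ cancel-≉0 (f≉0 zero)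

    -- Puts 1# at the index of 0#, so that a product over all N indices is a product over the
    -- nonzero elements and no enumeration of these is required.
    ifZero : ∀ {x} → Dec (x ≈ 0#) → Carrier → Carrier
    ifZero (yes _) y = 1#
    ifZero (no _)  y = y

    ifZero-nonzero : ∀ {x} (d : Dec (x ≈ 0#)) → ¬ ifZero d x ≈ 0#
    ifZero-nonzero (yes _)   = 1≉0
    ifZero-nonzero (no x≉0) = x≉0

    ifZero-* : ∀ {x y z} → ¬ x ≈ 0# → z ≈ x * y → (d : Dec (y ≈ 0#)) (e : Dec (z ≈ 0#)) → ifZero e z ≈ ifZero d x * ifZero d y
    ifZero-* x≉0 z≈xy (yes y≈0) (yes z≈0) = sym (*-identityˡ 1#)
    ifZero-* x≉0 z≈xy (yes y≈0) (no z≉0)  = contradiction (trans z≈xy (trans (*-congˡ y≈0) (zeroʳ _))) z≉0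
    ifZero-* x≉0 z≈xy (no y≉0)  (yes z≈0) = contradiction (cancel-≉0 x≉0 (trans (sym z≈xy) z≈0)) y≉0
    ifZero-* x≉0 z≈xy (no y≉0)  (no z≉0)  = z≈xy

    0^card≈0 : ∀ {n} → Fin n → 0# ^ n ≈ 0#
    0^card≈0 {suc n} _ = zeroˡ _

  -- Multiplication by x ≉ 0# permutes the nonzero elements, so their product is
  -- unchanged when each factor is multiplied by x.
  fermat : ∀ x → x ^ N ≈ x
  fermat x with x ≟ 0#
  ... | yes x≈0 = trans (^-congˡ N x≈0) (trans (0^card≈0 (to 0#)) (sym x≈0))
  ... | no x≉0 = begin
    x ^ N          ≈⟨ *∏≈^ (to 0#) xs x xs-0 xs-≢ ⟨
    x * ∏.sum xs   ≈⟨ *-congˡ ∏xs≈1 ⟩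
    x * 1#         ≈⟨ *-identityʳ x ⟩
    x              ∎
    where
    x⁻¹ = proj₁ (inverse x≉0)
    xx⁻¹≈1 : x * x⁻¹ ≈ 1#
    xx⁻¹≈1 = trans (*-comm x x⁻¹) (proj₂ (inverse x≉0))
    scale = translation (x *_) (x⁻¹ *_) *-congˡ *-congˡ
      (λ y → trans (sym (*-assoc _ _ y)) (trans (*-congʳ xx⁻¹≈1) (*-identityˡ y)))
      (λ y → trans (sym (*-assoc _ _ y)) (trans (*-congʳ (proj₂ (inverse x≉0))) (*-identityˡ y)))
    xs nonzeros : Vector Carrier N
    xs i = ifZero (from i ≟ 0#) x
    nonzeros i = ifZero (from i ≟ 0#) (from i)
    xs-0 : xs (to 0#) ≈ 1#
    xs-0 with from (to 0#) ≟ 0#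
    ... | yes _  = refl
    ... | no ≉0 = contradiction (strictlyInverseʳ 0#) ≉0
    xs-≢ : ∀ j → j ≢ to 0# → xs j ≈ x
    xs-≢ j j≢ with from j ≟ 0#
    ... | yes ≈0 = contradiction (≡.trans (≡.sym (strictlyInverseˡ j)) (to-cong ≈0)) j≢
    ... | no _   = refl
    P = ∏.sum nonzeros
    P≉0 : ¬ P ≈ 0#
    P≉0 = ∏≉0 nonzeros λ i → ifZero-nonzero (from i ≟ 0#)
    P≈xsP : P ≈ ∏.sum xs * P
    P≈xsP = begin
      P                                      ≈⟨ ∏.sum-permute nonzeros scale ⟩
      ∏.sum (nonzeros ∘ to ∘ (x *_) ∘ from)  ≈⟨ ∏.sum-cong-≋ (λ i → ifZero-* x≉0 (strictlyInverseʳ _) (from i ≟ 0#) (from (to (x * from i)) ≟ 0#)) ⟩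
      ∏.sum (λ i → xs i * nonzeros i)        ≈⟨ ∏.∑-distrib-+ xs nonzeros ⟩
      ∏.sum xs * P                           ∎
    ∏xs≈1 : ∏.sum xs ≈ 1#
    ∏xs≈1 = let Q , QP≈1 = inverse P≉0 in begin
      ∏.sum xs            ≈⟨ *-identityʳ _ ⟨
      ∏.sum xs * 1#       ≈⟨ *-congˡ (trans (*-comm P Q) QP≈1) ⟨
      ∏.sum xs * (P * Q)  ≈⟨ *-assoc _ P Q ⟨
      ∏.sum xs * P * Q    ≈⟨ *-congʳ P≈xsP ⟨
      P * Q               ≈⟨ *-comm P Q ⟩
      Q * P               ≈⟨ QP≈1 ⟩
      1#                  ∎

-- Roots of polynomial functions and the Frobenius map

module RingIdentities {c ℓ} (R : CommutativeRing c ℓ) where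
  private
    ring : AlmostCommutativeRing c ℓ
    ring = fromCommutativeRing R (λ _ → nothing)
  open CommutativeRing R using (Carrier)
  open AlmostCommutativeRing ring hiding (Carrier)

  -- These two identities are the steps of synthetic division; δ stands for x - a, which keeps
  -- negation out of them.
  linear-shift : ∀ a δ b → b + (a + δ) * 1# ≈ (b + a * 1#) + δ * 1#
  linear-shift = solve-∀ ring

  horner-shift : ∀ a δ b y z → b + (a + δ) * (y + δ * z) ≈ (b + a * y) + δ * (y + (a + δ) * z)
  horner-shift = solve-∀ ring

p∣n!⇒p≤n : ∀ {p} → Prime p → ∀ n → p ∣ n ! → p ≤ n
p∣n!⇒p≤n pp zero p∣1 = contradiction (ℕ.nonTrivial⇒n>1 _ ⦃ prime⇒nonTrivial pp ⦄) (ℕ.≤⇒≯ (∣⇒≤ p∣1))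
p∣n!⇒p≤n pp (suc n) p∣ with euclidsLemma (suc n) (n !) pp p∣
... | inj₁ p∣1+n = ∣⇒≤ p∣1+n
... | inj₂ p∣n! = ℕ.m≤n⇒m≤1+n (p∣n!⇒p≤n pp n p∣n!)

-- The prime divides p ! but neither of the factorials in the denominator, both being factorials of
-- numbers below p.
p∣pCk : ∀ {p} → Prime p → ∀ {k} → 0 < k → k < p → p ∣ p C k
p∣pCk {zero} pp _ ()
p∣pCk {p@(suc p-1)} pp {k} 0<k k<p with euclidsLemma (p C k) (k ! ℕ.* (p ℕ.∸ k) !) pp p∣product
  where
  k≤p = ℕ.<⇒≤ k<p
  instance _ = (k ℕ.!* (p ℕ.∸ k) !≢0)
  product≡p! : (p C k) ℕ.* (k ! ℕ.* (p ℕ.∸ k) !) ≡ p !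
  product≡p! = ≡.trans (≡.cong (ℕ._* (k ! ℕ.* (p ℕ.∸ k) !)) (nCk≡n!/k![n-k]! k≤p)) (m/n*n≡m (k![n∸k]!∣n! k≤p))
  p∣product : p ∣ (p C k) ℕ.* (k ! ℕ.* (p ℕ.∸ k) !)
  p∣product = ≡.subst (p ∣_) (≡.sym product≡p!) (m∣m*n (p-1 !))
... | inj₁ p∣C = p∣C
... | inj₂ p∣k![p-k]! with euclidsLemma (k !) ((p ℕ.∸ k) !) pp p∣k![p-k]!
... | inj₁ p∣k! = contradiction (p∣n!⇒p≤n pp k p∣k!) (ℕ.<⇒≱ k<p)
... | inj₂ p∣[p-k]! = contradiction (p∣n!⇒p≤n pp (p ℕ.∸ k) p∣[p-k]!) (ℕ.<⇒≱ (ℕ.∸-monoʳ-< 0<k (ℕ.<⇒≤ k<p)))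

module Polynomial {c ℓ₁ ℓ₂} (F : HeytingField c ℓ₁ ℓ₂) {N : ℕ} (card : HasCardinality F N) where

  open CommutativeRing (ringOf F) hiding (zero)
  open RingProperties ring

  open CommutativeExp commutativeSemiring
  open SetoidReasoning setoid
  open FiniteField F card
  open RingIdentities (ringOf F)
  open SemiringMult semiring using (×1-homo-*; ×-assoc-*)
  open Mult +-monoid using (×-congʳ; ×-congˡ; ×-homo-1) renaming (_×_ to _×#_)
  open CommutativeMonoidSum +-commutativeMonoid

  -- A polynomial is its function together with a Horner scheme. The degree belongs to the scheme
  -- and not to the function: on a field with N elements x ^ N and x are the same function.
  data Monic : ℕ → (Carrier → Carrier) → Set (c Level.⊔ ℓ₁) where
    one  : ∀ {f} → (∀ x → f x ≈ 1#) → Monic 0 f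
    step : ∀ {r f g} a → Monic r g → (∀ x → f x ≈ a + x * g x) → Monic (suc r) f

  data Degree< : ℕ → (Carrier → Carrier) → Set (c Level.⊔ ℓ₁) where
    zero : ∀ {f} → (∀ x → f x ≈ 0#) → Degree< 0 f
    step : ∀ {r f g} a → Degree< r g → (∀ x → f x ≈ a + x * g x) → Degree< (suc r) f

  x≈a+[x-a] : ∀ x a → x ≈ a + (x - a)
  x≈a+[x-a] x a = sym (begin
    a + (x - a)    ≈⟨ +-comm a _ ⟩
    x - a + a      ≈⟨ +-assoc x _ a ⟩
    x + (- a + a)  ≈⟨ +-congˡ (-‿inverseˡ a) ⟩
    x + 0#         ≈⟨ +-identityʳ x ⟩
    x              ∎)

  -- Synthetic division: the values at a of the successive Horner tails are the coefficients of the
  -- quotient, and f a is the remainder.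
  division : ∀ {r f} → Monic (suc r) f → ∀ a → ∃[ g ] Monic r g × (∀ x → f x ≈ f a + (x - a) * g x)
  division {f = f} (step {g = g} b (one g≈1) f≈) a = (λ _ → 1#) , one (λ _ → refl) , λ x → begin
    f x                             ≈⟨ trans (f≈ x) (+-congˡ (*-cong (x≈a+[x-a] x a) (g≈1 x))) ⟩
    b + (a + (x - a)) * 1#          ≈⟨ linear-shift a (x - a) b ⟩
    (b + a * 1#) + (x - a) * 1#     ≈⟨ +-congʳ (trans (f≈ a) (+-congˡ (*-congˡ (g≈1 a)))) ⟨
    f a + (x - a) * 1#              ∎
  division {f = f} (step {g = g} b g-monic@(step _ _ _) f≈) a with division g-monic a
  ... | h , h-monic , g≈ = (λ x → g a + x * h x) , step (g a) h-monic (λ _ → refl) , λ x → begin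
    f x                                                    ≈⟨ trans (f≈ x) (+-congˡ (*-cong (x≈a+[x-a] x a) (g≈ x))) ⟩
    b + (a + (x - a)) * (g a + (x - a) * h x)              ≈⟨ horner-shift a (x - a) b (g a) (h x) ⟩
    (b + a * g a) + (x - a) * (g a + (a + (x - a)) * h x)  ≈⟨ +-cong (f≈ a) (*-congˡ (+-congˡ (*-congʳ (x≈a+[x-a] x a)))) ⟨
    f a + (x - a) * (g a + x * h x)                        ∎

  -- Divide by the linear factor of the first root; the other roots differ from it, so they are
  -- roots of the quotient.
  roots≤degree : ∀ {r f} → Monic r f → ∀ {k} (root : Fin k → Carrier) → (∀ {i j} → root i ≈ root j → i ≡ j) →
                 (∀ i → f (root i) ≈ 0#) → k ≤ r
  roots≤degree _ {zero} _ _ _ = z≤n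
  roots≤degree (one f≈1) {suc k} root _ f-root = contradiction (trans (sym (f≈1 _)) (f-root zero)) 1≉0
  roots≤degree {f = f} f-monic@(step _ _ _) {suc k} root root-inj f-root with division f-monic (root zero)
  ... | g , g-monic , f≈ = s≤s (roots≤degree g-monic (root ∘ suc) (Fin.suc-injective ∘ root-inj) λ i →
    cancel-≉0 (λ ≈0 → contradiction (root-inj (x-y≈0⇒x≈y ≈0)) λ ()) (begin
      (root (suc i) - root zero) * g (root (suc i))                   ≈⟨ +-identityˡ _ ⟨
      0# + (root (suc i) - root zero) * g (root (suc i))              ≈⟨ +-congʳ (f-root zero) ⟨
      f (root zero) + (root (suc i) - root zero) * g (root (suc i))   ≈⟨ f≈ _ ⟨
      f (root (suc i))                                                ≈⟨ f-root (suc i) ⟩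
      0#                                                              ∎))
    where
    x-y≈0⇒x≈y : ∀ {x y} → x - y ≈ 0# → x ≈ y
    x-y≈0⇒x≈y {x} {y} eq = trans (+-inverseˡ-unique x (- y) eq) (-‿involutive y)

  degree<-zero : ∀ r → Degree< r (λ _ → 0#)
  degree<-zero zero    = zero (λ _ → refl)
  degree<-zero (suc r) = step 0# (degree<-zero r) (λ x → sym (trans (+-identityˡ _) (zeroʳ x)))

  private
    shift : ∀ (f g : Carrier → Carrier) → (∀ x → f x ≈ x * g x) → ∀ x → f x ≈ 0# + x * g x
    shift f g f≈ x = trans (f≈ x) (sym (+-identityˡ _))

    step-+ : ∀ {f f′ g g′ : Carrier → Carrier} {a b} → (∀ x → f x ≈ a + x * g x) → (∀ x → f′ x ≈ b + x * g′ x) →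
             ∀ x → f x + f′ x ≈ (a + b) + x * (g x + g′ x)
    step-+ {f} {f′} {g} {g′} {a} {b} f≈ f′≈ x = begin
      f x + f′ x                         ≈⟨ +-cong (f≈ x) (f′≈ x) ⟩
      (a + x * g x) + (b + x * g′ x)     ≈⟨ +-assoc _ _ _ ⟩
      a + (x * g x + (b + x * g′ x))     ≈⟨ +-congˡ (trans (sym (+-assoc _ _ _)) (trans (+-congʳ (+-comm _ _)) (+-assoc _ _ _))) ⟩
      a + (b + (x * g x + x * g′ x))     ≈⟨ +-assoc _ _ _ ⟨
      (a + b) + (x * g x + x * g′ x)     ≈⟨ +-congˡ (distribˡ x _ _) ⟨
      (a + b) + x * (g x + g′ x)         ∎

  degree<-+ : ∀ {r f g} → Degree< r f → Degree< r g → Degree< r (λ x → f x + g x)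
  degree<-+ (zero f≈) (zero g≈)         = zero (λ x → trans (+-cong (f≈ x) (g≈ x)) (+-identityˡ 0#))
  degree<-+ (step a f f≈) (step b g g≈) = step (a + b) (degree<-+ f g) (step-+ f≈ g≈)

  monic-+ : ∀ {r f g} → Degree< r f → Monic r g → Monic r (λ x → f x + g x)
  monic-+ (zero f≈) (one g≈)          = one (λ x → trans (+-cong (f≈ x) (g≈ x)) (+-identityˡ 1#))
  monic-+ (step a f f≈) (step b g g≈) = step (a + b) (monic-+ f g) (step-+ f≈ g≈)

  monic-^ : ∀ r → Monic r (_^ r)
  monic-^ zero    = one (λ _ → refl)
  monic-^ (suc r) = step 0# (monic-^ r) (λ x → sym (+-identityˡ _))

  degree<-monic : ∀ {r s f} → r < s → Monic r f → Degree< s f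
  degree<-monic {s = suc s} _ (one f≈1) = step 1# (degree<-zero s) λ x → trans (f≈1 x) (sym (trans (+-congˡ (zeroʳ x)) (+-identityʳ 1#)))
  degree<-monic {s = suc s} (s≤s r<s) (step a g f≈) = step a (degree<-monic r<s g) f≈

  degree<-negated : ∀ {s} → 1 < s → Degree< s (-_)
  degree<-negated {suc zero} (s≤s ())
  degree<-negated {suc (suc s)} _ = step 0# (step (- 1#) (degree<-zero s) (λ x → refl)) λ x → begin
    - x                              ≈⟨ -‿cong (*-identityʳ x) ⟨
    - (x * 1#)                       ≈⟨ -‿distribʳ-* x 1# ⟩
    x * - 1#                         ≈⟨ *-congˡ (trans (+-congˡ (zeroʳ x)) (+-identityʳ _)) ⟨
    x * (- 1# + x * 0#)              ≈⟨ +-identityˡ _ ⟨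
    0# + x * (- 1# + x * 0#)         ∎

  -- The vanishing element N ×# 1# is a power of p ×# 1#, and a field has no zero divisors.
  characteristic : ∀ {p} j → N ≡ p ℕ.^ j → p ×# 1# ≈ 0#
  characteristic {p} j N≡ = go j (trans (×-congˡ (≡.sym N≡)) card×1≈0)
    where
    go : ∀ j → (p ℕ.^ j) ×# 1# ≈ 0# → p ×# 1# ≈ 0#
    go zero 1×1≈0 = contradiction (trans (sym (×-homo-1 1#)) 1×1≈0) 1≉0
    go (suc j) eq with p ×# 1# ≟ 0#
    ... | yes p≈0 = p≈0
    ... | no p≉0 = go j (cancel-≉0 p≉0 (trans (sym (×1-homo-* p (p ℕ.^ j))) eq))

  module Frobenius {p} (pp : Prime p) (p≈0 : p ×# 1# ≈ 0#) where

    p∣n⇒n×x≈0 : ∀ {n} → p ∣ n → ∀ x → n ×# x ≈ 0#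
    p∣n⇒n×x≈0 {n} (divides s ≡.refl) x = begin
      (s ℕ.* p) ×# x                ≈⟨ ×-congʳ (s ℕ.* p) (*-identityˡ x) ⟨
      (s ℕ.* p) ×# (1# * x)         ≈⟨ ×-assoc-* (s ℕ.* p) 1# x ⟨
      (s ℕ.* p) ×# 1# * x           ≈⟨ *-congʳ (×1-homo-* s p) ⟩
      (s ×# 1#) * (p ×# 1#) * x     ≈⟨ *-congʳ (trans (*-congˡ p≈0) (zeroʳ _)) ⟩
      0# * x                        ≈⟨ zeroˡ x ⟩
      0#                            ∎

    -- In the binomial expansion every inner coefficient is a multiple of p, so only the first and
    -- the last term survive.
    +-^p : ∀ x y → (x + y) ^ p ≈ x ^ p + y ^ p
    +-^p x y = go p ≡.refl
      where
      open Binomial commutativeSemiring using (theorem; binomialTerm)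
      go : ∀ n → n ≡ p → (x + y) ^ n ≈ x ^ n + y ^ n
      go zero ≡.refl = contradiction (prime⇒nonZero pp) λ ()
      go (suc n) ≡.refl = begin
        (x + y) ^ p                                                                     ≈⟨ theorem p x y ⟩
        term zero + sum (term ∘ suc)                                                    ≈⟨ +-congˡ (sum-init-last (term ∘ suc)) ⟩
        term zero + (sum (λ i → term (suc (inject₁ i))) + term (suc (fromℕ n)))         ≈⟨ +-cong term-first (+-cong (trans (sum-cong-≋ term-middle) (sum-replicate-zero n)) term-last) ⟩
        y ^ p + (0# + x ^ p)                                                            ≈⟨ +-congˡ (+-identityˡ _) ⟩
        y ^ p + x ^ p                                                                   ≈⟨ +-comm _ _ ⟩
        x ^ p + y ^ p                                                                   ∎
        where
        term = binomialTerm x y p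
        term-first : term zero ≈ y ^ p
        term-first = trans (×-homo-1 _) (*-identityˡ _)
        term-middle : ∀ i → term (suc (inject₁ i)) ≈ 0#
        term-middle i = p∣n⇒n×x≈0 (p∣pCk pp (s≤s z≤n) (s≤s (≡.subst (_< n) (≡.sym (Fin.toℕ-inject₁ i)) (Fin.toℕ<n i)))) _
        term-last : term (suc (fromℕ n)) ≈ x ^ p
        term-last = begin
          term (suc (fromℕ n))                              ≡⟨ ≡.cong (λ k → (p C suc k) ×# (x ^ suc k * y ^ (n ℕ.∸ k))) (Fin.toℕ-fromℕ n) ⟩
          (p C p) ×# (x ^ p * y ^ (n ℕ.∸ n))                ≡⟨ ≡.cong₂ (λ c k → c ×# (x ^ p * y ^ k)) (nCn≡1 p) (ℕ.n∸n≡0 n) ⟩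
          1 ×# (x ^ p * 1#)                                 ≈⟨ trans (×-homo-1 _) (*-identityʳ _) ⟩
          x ^ p                                             ∎

    +-^ : ∀ j x y → (x + y) ^ (p ℕ.^ j) ≈ x ^ (p ℕ.^ j) + y ^ (p ℕ.^ j)
    +-^ zero x y = trans (*-identityʳ _) (+-cong (sym (*-identityʳ x)) (sym (*-identityʳ y)))
    +-^ (suc j) x y = begin
      (x + y) ^ (p ℕ.* p ℕ.^ j)                  ≈⟨ ^-assocʳ (x + y) p (p ℕ.^ j) ⟨
      ((x + y) ^ p) ^ (p ℕ.^ j)                  ≈⟨ ^-congˡ (p ℕ.^ j) (+-^p x y) ⟩
      (x ^ p + y ^ p) ^ (p ℕ.^ j)                ≈⟨ +-^ j _ _ ⟩
      (x ^ p) ^ (p ℕ.^ j) + (y ^ p) ^ (p ℕ.^ j)  ≈⟨ +-cong (^-assocʳ x p _) (^-assocʳ y p _) ⟩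
      x ^ (p ℕ.* p ℕ.^ j) + y ^ (p ℕ.* p ℕ.^ j)  ∎

-- Linear algebra over a finite field

module LinearAlgebra
  {c ℓ₁ ℓ₂ c′ ℓ₁′ ℓ₂′ : Level}
  {K : HeytingField c ℓ₁ ℓ₂} {L : HeytingField c′ ℓ₁′ ℓ₂′}
  (E : ProperFieldExtension K L) {q m : ℕ}
  (card-K : HasCardinality K q) (card-L : HasCardinality L (q ℕ.^ m))
  where

  open LinearMatching E
  open ProperFieldExtension E using (embed; isRingMonomorphism)
  module K where
    open CommutativeRing (ringOf K) public
    open RingProperties ring public
    open FiniteField K card-K public
    open Inverse card-K public using (to; from; to-cong; strictlyInverseˡ; strictlyInverseʳ)
  open CommutativeRing (ringOf L) hiding (zero)
  open RingProperties ring
  open FiniteField L card-L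
  private module ≈-Reasoning = SetoidReasoning setoid
  open CommutativeMonoidSum +-commutativeMonoid using (sum; sum-remove)
  open IsRingMonomorphism isRingMonomorphism using (⟦⟧-cong; +-homo; *-homo; 0#-homo; 1#-homo; -‿homo)

  private variable
    n r s : ℕ
    p p′ : Level
    us vs ws : Vec Carrier n
    x y z v : Carrier
    k l : K.Carrier

  ·-congˡ : ∀ k {x y} → x ≈ y → k · x ≈ k · y
  ·-congˡ k = *-congˡ

  ·-congʳ : k K.≈ l → k · x ≈ l · x
  ·-congʳ k≈l = *-congʳ (⟦⟧-cong k≈l)

  ·-distribˡ : ∀ k x y → k · (x + y) ≈ k · x + k · y
  ·-distribˡ k = distribˡ (embed k)

  ·-distribʳ : ∀ x k l → (k K.+ l) · x ≈ k · x + l · x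
  ·-distribʳ x k l = trans (*-congʳ (+-homo k l)) (distribʳ x _ _)

  ·-assoc : ∀ k l x → (k K.* l) · x ≈ k · (l · x)
  ·-assoc k l x = trans (*-congʳ (*-homo k l)) (*-assoc _ _ x)

  ·-zeroˡ : ∀ x → K.0# · x ≈ 0#
  ·-zeroˡ x = trans (*-congʳ 0#-homo) (zeroˡ x)

  ·-zeroʳ : ∀ k → k · 0# ≈ 0#
  ·-zeroʳ k = zeroʳ (embed k)

  ·-identityˡ : ∀ x → K.1# · x ≈ x
  ·-identityˡ x = trans (*-congʳ 1#-homo) (*-identityˡ x)

  -‿· : ∀ k x → (K.- k) · x ≈ - (k · x)
  -‿· k x = trans (*-congʳ (-‿homo k)) (sym (-‿distribˡ-* (embed k) x))

  -1· : ∀ x → (K.- K.1#) · x ≈ - x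
  -1· x = trans (-‿· K.1# x) (-‿cong (·-identityˡ x))

  *-·-comm : ∀ x k y → x * (k · y) ≈ k · (x * y)
  *-·-comm x k y = trans (sym (*-assoc x _ y)) (trans (*-congʳ (*-comm x _)) (*-assoc _ x y))

  x-y+y≈x : ∀ x y → x - y + y ≈ x
  x-y+y≈x x y = trans (+-assoc x _ y) (trans (+-congˡ (-‿inverseˡ y)) (+-identityʳ x))

  x+y-y≈x : ∀ x y → x + y - y ≈ x
  x+y-y≈x x y = trans (+-assoc x y _) (trans (+-congˡ (-‿inverseʳ y)) (+-identityʳ x))

  x+y-x≈y : ∀ x y → x + y - x ≈ y
  x+y-x≈y x y = trans (+-congʳ (+-comm x y)) (x+y-y≈x y x)

  +-interchange : ∀ w x y z → (w + x) + (y + z) ≈ (w + y) + (x + z)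
  +-interchange w x y z = begin
    (w + x) + (y + z)  ≈⟨ +-assoc w x _ ⟩
    w + (x + (y + z))  ≈⟨ +-congˡ (trans (sym (+-assoc x y z)) (trans (+-congʳ (+-comm x y)) (+-assoc y x z))) ⟩
    w + (y + (x + z))  ≈⟨ +-assoc w y _ ⟨
    (w + y) + (x + z)  ∎
    where
    open ≈-Reasoning

  module _ (V : Subspace p) where
    open Subspace V using (resp-≈; 0-closed; +-closed; ·-closed)

    -‿closed : x ∈ member V → - x ∈ member V
    -‿closed {x} x∈V = resp-≈ (-1· x) (·-closed (K.- K.1#) x∈V)

    minus-closed : x ∈ member V → y ∈ member V → x - y ∈ member V
    minus-closed x∈V y∈V = +-closed x∈V (-‿closed y∈V)

    +-cancelˡ-∈ : ∀ {x y} → x ∈ member V → x + y ∈ member V → y ∈ member V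
    +-cancelˡ-∈ {x} {y} x∈V x+y∈V = resp-≈ (x+y-x≈y x y) (minus-closed x+y∈V x∈V)

    +-cancelʳ-∈ : ∀ {x y} → y ∈ member V → x + y ∈ member V → x ∈ member V
    +-cancelʳ-∈ {x} {y} y∈V x+y∈V = resp-≈ (x+y-y≈x x y) (minus-closed x+y∈V y∈V)

    ·-cancel-∈ : ∀ {k x} → ¬ k K.≈ K.0# → k · x ∈ member V → x ∈ member V
    ·-cancel-∈ {k} {x} k≉0 kx∈V = let l , lk≈1 = K.inverse k≉0 in
      resp-≈ (trans (sym (·-assoc l k x)) (trans (·-congʳ lk≈1) (·-identityˡ x))) (·-closed l kx∈V)

    ∉⇒scalar≈0 : ∀ {k x} → x ∉ member V → k · x ∈ member V → k K.≈ K.0#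
    ∉⇒scalar≈0 {k} x∉V kx∈V with k K.≟ K.0#
    ... | yes k≈0 = k≈0
    ... | no k≉0 = contradiction (·-cancel-∈ k≉0 kx∈V) x∉V

    linearCombination-closed : ∀ {n} k (v : Vector Carrier n) → (∀ i → v i ∈ member V) → linearCombination k v ∈ member V
    linearCombination-closed {zero} k v v∈ = 0-closed
    linearCombination-closed {suc n} k v v∈ = +-closed (·-closed _ (v∈ zero)) (linearCombination-closed (k ∘ suc) (v ∘ suc) (v∈ ∘ suc))

    ⟨⟩⊆ : ∀ {X : Pred Carrier p′} → X ⊆ member V → ⟨ X ⟩ ⊆ member V
    ⟨⟩⊆ X⊆V (n , v , k , v∈X , x≈) = resp-≈ (sym x≈) (linearCombination-closed k v (X⊆V ∘ v∈X))

  -- Subspaces, spans of vectors and independence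

  _⊓_ : Subspace p → Subspace p′ → Subspace (p ⊔ p′)
  V ⊓ W = record
    { member   = member V ∩ member W
    ; resp-≈   = λ x≈y (x∈V , x∈W) → V.resp-≈ x≈y x∈V , W.resp-≈ x≈y x∈W
    ; 0-closed = V.0-closed , W.0-closed
    ; +-closed = λ (x∈V , x∈W) (y∈V , y∈W) → V.+-closed x∈V y∈V , W.+-closed x∈W y∈W
    ; ·-closed = λ k (x∈V , x∈W) → V.·-closed k x∈V , W.·-closed k x∈W
    }
    where
    module V = Subspace V
    module W = Subspace W

  _⁻¹[_] : Carrier → Subspace p → Subspace p
  a ⁻¹[ V ] = record
    { member   = λ x → a * x ∈ member V
    ; resp-≈   = λ x≈y → resp-≈ (*-congˡ x≈y)
    ; 0-closed = resp-≈ (sym (zeroʳ a)) 0-closed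
    ; +-closed = λ x∈ y∈ → resp-≈ (sym (distribˡ a _ _)) (+-closed x∈ y∈)
    ; ·-closed = λ k x∈ → resp-≈ (sym (*-·-comm a k _)) (·-closed k x∈)
    }
    where
    open Subspace V

  -- An inductive counterpart of `⟨_⟩` for a fixed list of generators. It supports induction on the
  -- list, and it is decidable because the leading scalar can be searched for in the finite field K.
  data Span : Vec Carrier n → Pred Carrier (c ⊔ c′ ⊔ ℓ₁′) where
    nil  : x ≈ 0# → Span [] x
    cons : ∀ k → Span vs y → x ≈ k · v + y → Span (v ∷ vs) x

  span-resp : x ≈ y → Span vs x → Span vs y
  span-resp x≈y (nil x≈0)       = nil (trans (sym x≈y) x≈0)
  span-resp x≈y (cons k y∈ x≈) = cons k y∈ (trans (sym x≈y) x≈)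

  span-0 : ∀ {vs : Vec Carrier n} → Span vs 0#
  span-0 {vs = []}     = nil refl
  span-0 {vs = v ∷ vs} = cons K.0# span-0 (sym (trans (+-identityʳ _) (·-zeroˡ v)))

  span-+ : Span vs x → Span vs y → Span vs (x + y)
  span-+ (nil x≈0) (nil y≈0)                 = nil (trans (+-cong x≈0 y≈0) (+-identityˡ 0#))
  span-+ (cons k x∈ x≈) (cons l y∈ y≈)       = cons (k K.+ l) (span-+ x∈ y∈) (trans (+-cong x≈ y≈)
    (trans (+-interchange _ _ _ _) (+-congʳ (sym (·-distribʳ _ k l)))))

  span-· : ∀ k → Span vs x → Span vs (k · x)
  span-· k (nil x≈0) = nil (trans (·-congˡ k x≈0) (·-zeroʳ k))
  span-· k (cons l y∈ x≈) = cons (k K.* l) (span-· k y∈) (trans (·-congˡ k x≈) (trans (·-distribˡ k _ _) (+-congʳ (sym (·-assoc k l _)))))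

  span : Vec Carrier n → Subspace (c ⊔ c′ ⊔ ℓ₁′)
  span vs = record { member = Span vs ; resp-≈ = span-resp ; 0-closed = span-0 ; +-closed = span-+ ; ·-closed = λ k → span-· k }

  span? : (vs : Vec Carrier n) → Decidable (Span vs)
  span? [] x = map′ nil (λ { (nil x≈0) → x≈0 }) (x ≟ 0#)
  span? (v ∷ vs) x = map′
    (λ (k , x-kv∈) → cons k x-kv∈ (sym (trans (+-comm _ _) (x-y+y≈x x _))))
    (λ { (cons k y∈ x≈) → k , span-resp (sym (trans (+-congʳ x≈) (x+y-x≈y _ _))) y∈ })
    (K.search (λ k≈l → span-resp (+-congˡ (-‿cong (·-congʳ k≈l)))) (λ k → span? vs (x - k · v)))

  span-∷⁺ : ∀ v → Span vs x → Span (v ∷ vs) x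
  span-∷⁺ v x∈ = cons K.0# x∈ (sym (trans (+-congʳ (·-zeroˡ v)) (+-identityˡ _)))

  span-head : ∀ (vs : Vec Carrier n) → Span (v ∷ vs) v
  span-head vs = cons K.1# span-0 (sym (trans (+-identityʳ _) (·-identityˡ _)))

  span-lookup : ∀ (vs : Vec Carrier n) i → Span vs (lookup vs i)
  span-lookup (v ∷ vs) zero    = span-head vs
  span-lookup (v ∷ vs) (suc i) = span-∷⁺ v (span-lookup vs i)

  span⊆ : (V : Subspace p) → All (member V) vs → Span vs ⊆ member V
  span⊆ V [] (nil x≈0) = Subspace.resp-≈ V (sym x≈0) (Subspace.0-closed V)
  span⊆ V (v∈V ∷ vs∈V) (cons k y∈ x≈) = Subspace.resp-≈ V (sym x≈)
    (Subspace.+-closed V (Subspace.·-closed V k v∈V) (span⊆ V vs∈V y∈))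

  span⊆⇒all : ∀ {P : Pred Carrier p} (vs : Vec Carrier n) → Span vs ⊆ P → All P vs
  span⊆⇒all [] _ = []
  span⊆⇒all (v ∷ vs) ⊆P = ⊆P (span-head vs) ∷ span⊆⇒all vs (⊆P ∘ span-∷⁺ v)

  span-++ʳ : ∀ (us : Vec Carrier n) → Span vs x → Span (us ⧺ vs) x
  span-++ʳ []       x∈ = x∈
  span-++ʳ (u ∷ us) x∈ = span-∷⁺ u (span-++ʳ us x∈)

  span-++⁺ : Span us x → Span vs y → Span (us ⧺ vs) (x + y)
  span-++⁺ (nil x≈0) y∈ = span-resp (sym (trans (+-congʳ x≈0) (+-identityˡ _))) y∈
  span-++⁺ (cons k x∈ x≈) y∈ = cons k (span-++⁺ x∈ y∈) (trans (+-congʳ x≈) (+-assoc _ _ _))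

  span-++ˡ : ∀ {us : Vec Carrier n} {vs : Vec Carrier r} → Span us x → Span (us ⧺ vs) x
  span-++ˡ x∈ = span-resp (+-identityʳ _) (span-++⁺ x∈ span-0)

  span-++⁻ : ∀ (us : Vec Carrier n) → Span (us ⧺ vs) x → ∃[ y ] ∃[ z ] Span us y × Span vs z × x ≈ y + z
  span-++⁻ [] x∈ = 0# , _ , nil refl , x∈ , sym (+-identityˡ _)
  span-++⁻ (u ∷ us) (cons k x∈ x≈) = let y , z , y∈ , z∈ , eq = span-++⁻ us x∈ in
    k · u + y , z , cons k y∈ refl , z∈ , trans x≈ (trans (+-congˡ eq) (sym (+-assoc _ _ _)))

  linearCombination∈span : ∀ (vs : Vec Carrier n) k → Span vs (linearCombination k (lookup vs))
  linearCombination∈span vs k = linearCombination-closed (span vs) k (lookup vs) (span-lookup vs)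

  coefficients : Span vs x → ∃[ k ] x ≈ linearCombination k (lookup vs)
  coefficients (nil x≈0) = (λ ()) , x≈0
  coefficients (cons k y∈ x≈) = let ks , y≈ = coefficients y∈ in k ◂ ks , trans x≈ (+-congˡ y≈)

  -- Each vector lies outside the span of those after it. A basis thus grows by one vector at a
  -- time, and no equation between coefficients has to be solved.
  data Independent : Vec Carrier n → Set (c ⊔ c′ ⊔ ℓ₁′) where
    []  : Independent []
    _∷_ : v ∉ Span vs → Independent vs → Independent (v ∷ vs)

  coefficients-unique : Independent vs → ∀ k l → linearCombination k (lookup vs) ≈ linearCombination l (lookup vs) → ∀ i → k i K.≈ l i
  coefficients-unique {vs = v ∷ vs} (v∉ ∷ vs-indep) k l eq = λ
    { zero    → k₀≈l₀
    ; (suc i) → coefficients-unique vs-indep (k ∘ suc) (l ∘ suc) (+-cancelˡ (k zero · v) _ _ (trans eq (+-congʳ (·-congʳ (K.sym k₀≈l₀))))) i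
    }
    where
    X = linearCombination (k ∘ suc) (lookup vs)
    Y = linearCombination (l ∘ suc) (lookup vs)
    difference : (k zero K.- l zero) · v + X ≈ Y
    difference = begin
      (k zero K.- l zero) · v + X           ≈⟨ +-congʳ (trans (·-distribʳ v _ _) (+-congˡ (-‿· (l zero) v))) ⟩
      k zero · v - l zero · v + X           ≈⟨ trans (+-assoc _ _ _) (trans (+-congˡ (+-comm _ _)) (sym (+-assoc _ _ _))) ⟩
      k zero · v + X - l zero · v           ≈⟨ +-congʳ eq ⟩
      l zero · v + Y - l zero · v           ≈⟨ x+y-x≈y _ Y ⟩
      Y                                     ∎
      where
      open ≈-Reasoning
    k₀≈l₀ : k zero K.≈ l zero
    k₀≈l₀ = K.trans (K.+-inverseˡ-unique _ _ (∉⇒scalar≈0 (span vs) v∉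
      (+-cancelʳ-∈ (span vs) (linearCombination∈span vs _) (span-resp (sym difference) (linearCombination∈span vs _))))) (K.-‿involutive _)

  linearCombination-0 : ∀ (v : Vector Carrier n) → linearCombination (λ _ → K.0#) v ≈ 0#
  linearCombination-0 {zero}  v = refl
  linearCombination-0 {suc n} v = trans (+-cong (·-zeroˡ _) (linearCombination-0 (v ∘ suc))) (+-identityˡ 0#)

  independent⇒linearlyIndependent : ∀ {vs : Vec Carrier n} → Independent vs → LinearlyIndependent (lookup vs)
  independent⇒linearlyIndependent {vs = vs} vs-indep k eq = coefficients-unique vs-indep k (λ _ → K.0#) (trans eq (sym (linearCombination-0 (lookup vs))))

  -- Dimension by counting linear combinations

  decode : Vec Carrier n → Fin (q ℕ.^ n) → Carrier
  decode {n} vs i = linearCombination (K.from ∘ finToFun {q} {n} i) (lookup vs)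

  linearCombination-cong : ∀ {k l : Vector K.Carrier n} (v : Vector Carrier n) → (∀ i → k i K.≈ l i) →
                           linearCombination k v ≈ linearCombination l v
  linearCombination-cong {zero}  v k≈l = refl
  linearCombination-cong {suc n} v k≈l = +-cong (·-congʳ (k≈l zero)) (linearCombination-cong (v ∘ suc) (k≈l ∘ suc))

  funToFin-cong : ∀ {n o} {f g : Fin n → Fin o} → (∀ i → f i ≡ g i) → funToFin f ≡ funToFin g
  funToFin-cong {zero}  f≗g = ≡.refl
  funToFin-cong {suc n} f≗g = ≡.cong₂ combine (f≗g zero) (funToFin-cong (f≗g ∘ suc))

  decode-injective : Independent vs → ∀ {i j} → decode vs i ≈ decode vs j → i ≡ j
  decode-injective {n} {vs} vs-indep {i} {j} eq = begin
    i                                  ≡⟨ Fin.funToFin-finToFin {n} {q} i ⟨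
    funToFin (finToFun {q} {n} i)      ≡⟨ funToFin-cong (λ a → ≡.trans (≡.sym (K.strictlyInverseˡ _)) (≡.trans (K.to-cong (coefficients-unique vs-indep _ _ eq a)) (K.strictlyInverseˡ _))) ⟩
    funToFin (finToFun {q} {n} j)      ≡⟨ Fin.funToFin-finToFin {n} {q} j ⟩
    j                                  ∎
    where
    open ≡.≡-Reasoning

  encode : Span vs x → ∃[ i ] decode vs i ≈ x
  encode {n} {vs} x∈ = let k , x≈ = coefficients x∈ in funToFin (K.to ∘ k) ,
    trans (linearCombination-cong (lookup vs) (λ a → K.trans (K.reflexive (≡.cong K.from (Fin.finToFun-funToFin (K.to ∘ k) a))) (K.strictlyInverseʳ _))) (sym x≈)

  1<q : 1 < q
  1<q = ℕ.≰⇒> λ q≤1 → K.1≉0 (K.trans (K.sym (K.strictlyInverseʳ _))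
    (K.trans (K.reflexive (≡.cong K.from (unique q≤1 _ _))) (K.strictlyInverseʳ _)))
    where
    unique : ∀ {o} → o ≤ 1 → (i j : Fin o) → i ≡ j
    unique (s≤s z≤n) zero zero = ≡.refl

  q^-cancel-≤ : ∀ {n r} → q ℕ.^ n ≤ q ℕ.^ r → n ≤ r
  q^-cancel-≤ {n} {r} qⁿ≤qʳ = ℕ.≮⇒≥ λ r<n → ℕ.<⇒≱ (ℕ.^-monoʳ-< q 1<q r<n) qⁿ≤qʳ

  -- The q^n combinations of vs are distinct, and each is one of at most q^r combinations of ws.
  steinitz : ∀ {vs : Vec Carrier n} {ws : Vec Carrier r} → Independent vs → Span vs ⊆ Span ws → n ≤ r
  steinitz {n} {r} {vs} {ws} vs-indep vs⊆ws = q^-cancel-≤ (Fin.injective⇒≤ {f = code} λ {i} {j} eq →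
    decode-injective vs-indep (trans (sym (proj₂ (code∃ i))) (trans (reflexive (≡.cong (decode ws) eq)) (proj₂ (code∃ j)))))
    where
    code∃ : ∀ i → ∃[ a ] decode ws a ≈ decode vs i
    code∃ i = encode (vs⊆ws (linearCombination∈span vs _))
    code : Fin (q ℕ.^ n) → Fin (q ℕ.^ r)
    code = proj₁ ∘ code∃

  private
    module L = Inverse card-L

  independent⇒≤m : Independent {n} vs → n ≤ m
  independent⇒≤m {vs = vs} vs-indep = q^-cancel-≤ (Fin.injective⇒≤ {f = L.to ∘ decode vs} λ eq → decode-injective vs-indep
    (trans (sym (L.strictlyInverseʳ _)) (trans (reflexive (≡.cong L.from eq)) (L.strictlyInverseʳ _))))

  spanning⇒m≤ : (∀ x → Span {n} vs x) → m ≤ n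
  spanning⇒m≤ {vs = vs} spanning = q^-cancel-≤ (Fin.injective⇒≤ {f = λ i → proj₁ (encode (spanning (L.from i)))} λ {i} {j} eq →
    ≡.trans (≡.sym (L.strictlyInverseˡ i)) (≡.trans (L.to-cong (trans (sym (proj₂ (encode (spanning _)))) (trans (reflexive (≡.cong (decode vs) eq)) (proj₂ (encode (spanning _)))))) (L.strictlyInverseˡ j)))

  ⊆span? : (V : Subspace p) → Decidable (member V) → (vs : Vec Carrier n) →
           member V ⊆ Span vs ⊎ (∃[ x ] x ∈ member V × x ∉ Span vs)
  ⊆span? V V? vs with search {P = λ x → x ∈ member V × x ∉ Span vs}
                        (λ x≈y (x∈V , x∉vs) → Subspace.resp-≈ V x≈y x∈V , x∉vs ∘ span-resp (sym x≈y))
                        (λ x → V? x ×-dec ¬? (span? vs x))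
  ... | yes witness   = inj₂ witness
  ... | no ¬witness = inj₁ λ {x} x∈V → decidable-stable (span? vs x) λ x∉vs → ¬witness (x , x∈V , x∉vs)

  record Extension (V : Subspace p) (vs : Vec Carrier n) (r : ℕ) : Set (c ⊔ c′ ⊔ ℓ₁′ ⊔ p) where
    field
      new         : Vec Carrier r
      independent : Independent (new ⧺ vs)
      contained      : Span (new ⧺ vs) ⊆ member V

  open Extension

  -- The number r is a target: either r new vectors fit into V, or fewer of them already span V.
  grow : (V : Subspace p) → Decidable (member V) → Independent vs → Span vs ⊆ member V → ∀ r →
         Extension V vs r ⊎ (∃[ s ] s < r × Σ[ X ∈ Extension V vs s ] member V ⊆ Span (new X ⧺ vs))
  grow V V? vs-indep vs⊆V zero = inj₁ record { new = [] ; independent = vs-indep ; contained = vs⊆V }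
  grow {vs = vs} V V? vs-indep vs⊆V (suc r) with grow V V? vs-indep vs⊆V r
  ... | inj₂ (s , s<r , X) = inj₂ (s , ℕ.m<n⇒m<1+n s<r , X)
  ... | inj₁ X with ⊆span? V V? (new X ⧺ vs)
  ...   | inj₁ V⊆X               = inj₂ (r , ℕ.n<1+n r , X , V⊆X)
  ...   | inj₂ (x , x∈V , x∉X) = inj₁ record
          { new = x ∷ new X
          ; independent = x∉X ∷ independent X
          ; contained = span⊆ V (x∈V ∷ span⊆⇒all _ (contained X)) }

  complete : ∀ {vs : Vec Carrier n} (V : Subspace p) → Decidable (member V) → Independent vs → Span vs ⊆ member V →
             ∃[ r ] Σ[ X ∈ Extension V vs r ] member V ⊆ Span (new X ⧺ vs)
  -- No m + 1 new vectors can be independent in L, so the target is never reached.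
  complete {n = n} V V? vs-indep vs⊆V with grow V V? vs-indep vs⊆V (suc m)
  ... | inj₁ X = contradiction (independent⇒≤m (independent X)) (ℕ.<⇒≱ (s≤s (ℕ.m≤m+n m n)))
  ... | inj₂ (s , _ , X) = s , X

  record Space : Set (c ⊔ c′ ⊔ ℓ₁′) where
    field
      {dim}             : ℕ
      basis             : Vec Carrier dim
      basis-independent : Independent basis

    subspace : Subspace (c ⊔ c′ ⊔ ℓ₁′)
    subspace = span basis

    Member : Pred Carrier (c ⊔ c′ ⊔ ℓ₁′)
    Member = Span basis

    member? : Decidable Member
    member? = span? basis

  open Space

  abstract
    -- Kept abstract, so that the basis search does not unfold; the result is used only through its
    -- equality with V.
    toSpace : (V : Subspace p) → Decidable (member V) → Σ[ W ∈ Space ] Member W ≐ member V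
    toSpace V V? = let r , X , V⊆ = complete V V? [] (λ { (nil x≈0) → Subspace.resp-≈ V (sym x≈0) (Subspace.0-closed V) }) in
      record { basis = new X ⧺ [] ; basis-independent = independent X } , contained X , V⊆

  dim-mono : ∀ V W → Member V ⊆ Member W → dim V ≤ dim W
  dim-mono V W = steinitz (basis-independent V)

  -- If u = y + z with y in the span of the later us and z in that of ws, then z = u - y lies in
  -- both spans, hence in the span of vs, and u would depend on the vectors after it in us ⧺ vs.
  independent-++ : ∀ (us : Vec Carrier n) → Independent (us ⧺ vs) → Independent ws →
                   (∀ {x} → Span us x → Span ws x → Span vs x) → Independent (us ⧺ ws)
  independent-++ [] _ ws-indep _ = ws-indep
  independent-++ {ws = ws} (u ∷ us) (u∉ ∷ us-indep) ws-indep us∩ws⊆vs =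
    (λ u∈ → let y , z , y∈us , z∈ws , u≈y+z = span-++⁻ us u∈ in
      u∉ (span-resp (sym u≈y+z) (span-++⁺ y∈us (us∩ws⊆vs
        (+-cancelˡ-∈ (span (u ∷ us)) (span-∷⁺ u y∈us) (span-resp u≈y+z (span-head us))) z∈ws))))
    ∷ independent-++ us us-indep ws-indep (us∩ws⊆vs ∘ span-∷⁺ u)

  -- A basis of I is completed to one of X. The new vectors are independent over Y because X ∩ Y ⊆
  -- I, and all of them lie in Z. Letting I and Z be bounds spares the callers exact sums and
  -- intersections.
  modular : ∀ X Y I Z → Member I ⊆ Member X → Member X ∩ Member Y ⊆ Member I →
            Member X ⊆ Member Z → Member Y ⊆ Member Z → dim X ℕ.+ dim Y ≤ dim I ℕ.+ dim Z
  modular X Y I Z I⊆X X∩Y⊆I X⊆Z Y⊆Z with complete (subspace X) (member? X) (basis-independent I) I⊆X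
  ... | r , ext , X⊆ext = begin
    dim X ℕ.+ dim Y            ≤⟨ ℕ.+-monoˡ-≤ (dim Y) (steinitz (basis-independent X) X⊆ext) ⟩
    (r ℕ.+ dim I) ℕ.+ dim Y    ≡⟨ ≡.cong (ℕ._+ dim Y) (ℕ.+-comm r (dim I)) ⟩
    (dim I ℕ.+ r) ℕ.+ dim Y    ≡⟨ ℕ.+-assoc (dim I) r (dim Y) ⟩
    dim I ℕ.+ (r ℕ.+ dim Y)    ≤⟨ ℕ.+-monoʳ-≤ (dim I) (steinitz ext∪Y-independent (span⊆ (subspace Z) ext∪Y⊆Z)) ⟩
    dim I ℕ.+ dim Z            ∎
    where
    open ℕ.≤-Reasoning
    new⊆X : Span (new ext) ⊆ Member X
    new⊆X x∈ = contained ext (span-++ˡ x∈)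
    ext∪Y-independent : Independent (new ext ⧺ basis Y)
    ext∪Y-independent = independent-++ (new ext) (independent ext) (basis-independent Y) λ x∈new x∈Y → X∩Y⊆I (new⊆X x∈new , x∈Y)
    ext∪Y⊆Z : All (Member Z) (new ext ⧺ basis Y)
    ext∪Y⊆Z = span⊆⇒all _ λ x∈ → let y , z , y∈ , z∈ , x≈ = span-++⁻ (new ext) x∈ in
      span-resp (sym x≈) (span-+ (X⊆Z (new⊆X y∈)) (Y⊆Z z∈))

  -- Subfields and the Dyson transform

  span-tabulate-coefficients : ∀ {n} (v : Vector Carrier n) → Span (tabulate v) x → ∃[ k ] x ≈ linearCombination k v
  span-tabulate-coefficients {n = zero}  v (nil x≈0)       = (λ ()) , x≈0
  span-tabulate-coefficients {n = suc n} v (cons k y∈ x≈) =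
    let ks , y≈ = span-tabulate-coefficients (v ∘ suc) y∈ in k ◂ ks , trans x≈ (+-congˡ y≈)

  span-tabulate : ∀ (v : Vector Carrier n) i → Span (tabulate v) (v i)
  span-tabulate v zero    = span-head _
  span-tabulate v (suc i) = span-∷⁺ (v zero) (span-tabulate (v ∘ suc) i)

  all-tabulate : ∀ {P : Pred Carrier p} (v : Vector Carrier n) → (∀ i → P (v i)) → All P (tabulate v)
  all-tabulate {n = zero}  v Pv = []
  all-tabulate {n = suc n} v Pv = Pv zero ∷ all-tabulate (v ∘ suc) (Pv ∘ suc)

  linearlyIndependent⇒independent : ∀ (v : Vector Carrier n) → LinearlyIndependent v → Independent (tabulate v)
  linearlyIndependent⇒independent {zero}  v v-indep = []
  linearlyIndependent⇒independent {suc n} v v-indep = v₀∉ ∷ linearlyIndependent⇒independent (v ∘ suc) λ k eq i →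
    v-indep (K.0# ◂ k) (trans (+-cong (·-zeroˡ (v zero)) eq) (+-identityˡ 0#)) (suc i)
    where
    v₀∉ : v zero ∉ Span (tabulate (v ∘ suc))
    v₀∉ v₀∈ with span-tabulate-coefficients (v ∘ suc) v₀∈
    ... | k , v₀≈ = K.1≉0 (K.trans (K.sym (K.-‿involutive K.1#)) (K.trans (K.-‿cong
      (v-indep ((K.- K.1#) ◂ k) (trans (+-cong (-1· (v zero)) (sym v₀≈)) (-‿inverseˡ (v zero))) zero)) K.-0#≈0#))

  orderedBasis⇒independent : ∀ {v : Vector Carrier n} (V : Subspace p) → IsOrderedBasis v V → Independent (tabulate v)
  orderedBasis⇒independent {v = v} V (v-indep , _) = linearlyIndependent⇒independent v v-indep

  orderedBasis⇒span : ∀ {v : Vector Carrier n} (V : Subspace p) → IsOrderedBasis v V → Span (tabulate v) ≐ member V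
  orderedBasis⇒span {v = v} V (_ , ⊆V , V⊆) =
    span⊆ V (all-tabulate v λ i → ⊆V (1 , (λ _ → v i) , (λ _ → K.1#) , (λ _ → i , refl) ,
      sym (trans (+-identityʳ _) (·-identityˡ _)))) ,
    λ x∈V → ⟨⟩⊆ (span (tabulate v)) {X = entries v} (λ { (i , x≈vi) → span-resp (sym x≈vi) (span-tabulate v i) }) (V⊆ x∈V)

  orderedBasis : ∀ {v : Vector Carrier n} (V : Subspace p) → LinearlyIndependent v → (∀ i → v i ∈ member V) →
                 (∀ {x} → x ∈ member V → ∃[ k ] x ≈ linearCombination k v) → IsOrderedBasis v V
  orderedBasis {v = v} V v-indep v∈V V⊆ = v-indep ,
    ⟨⟩⊆ V {X = entries v} (λ { (i , x≈vi) → Subspace.resp-≈ V (sym x≈vi) (v∈V i) }) ,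
    λ x∈V → let k , x≈ = V⊆ x∈V in _ , v , k , (λ i → i , refl) , x≈

  span-orderedBasis : Independent vs → IsOrderedBasis (lookup vs) (span vs)
  span-orderedBasis {vs = vs} vs-indep =
    orderedBasis (span vs) (independent⇒linearlyIndependent vs-indep) (span-lookup vs) coefficients

  independent-full : ∀ V {n} {vs : Vec Carrier n} → Independent vs → Span vs ⊆ Member V → dim V ≤ n → Member V ⊆ Span vs
  independent-full V {vs = vs} vs-indep vs⊆V dimV≤n with ⊆span? (subspace V) (member? V) vs
  ... | inj₁ V⊆vs               = V⊆vs
  ... | inj₂ (x , x∈V , x∉vs) =
    contradiction (steinitz (x∉vs ∷ vs-indep) (span⊆ (subspace V) (x∈V ∷ span⊆⇒all vs vs⊆V))) (ℕ.<⇒≱ (s≤s dimV≤n))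

  independent-disjoint : ∀ (us : Vec Carrier n) → Independent us → Independent ws → (∀ {x} → Span us x → Span ws x → x ≈ 0#) →
                         Independent (us ⧺ ws)
  independent-disjoint [] _ ws-indep _ = ws-indep
  independent-disjoint (u ∷ us) (u∉ ∷ us-indep) ws-indep disjoint =
    (λ u∈ → let y , z , y∈us , z∈ws , u≈y+z = span-++⁻ us u∈ in
      u∉ (span-resp (sym (trans u≈y+z (trans (+-congˡ (disjoint
        (+-cancelˡ-∈ (span (u ∷ us)) (span-∷⁺ u y∈us) (span-resp u≈y+z (span-head us))) z∈ws)) (+-identityʳ _)))) y∈us))
    ∷ independent-disjoint us us-indep ws-indep (disjoint ∘ span-∷⁺ u)

  span-scale⁺ : ∀ a → Span vs x → Span (map (a *_) vs) (a * x)
  span-scale⁺ a (nil x≈0) = nil (trans (*-congˡ x≈0) (zeroʳ a))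
  span-scale⁺ a (cons k y∈ x≈) = cons k (span-scale⁺ a y∈) (trans (*-congˡ x≈) (trans (distribˡ a _ _) (+-congʳ (*-·-comm a k _))))

  span-scale⁻ : ∀ a (vs : Vec Carrier n) → Span (map (a *_) vs) x → ∃[ y ] Span vs y × x ≈ a * y
  span-scale⁻ a [] (nil x≈0) = 0# , nil refl , trans x≈0 (sym (zeroʳ a))
  span-scale⁻ a (v ∷ vs) (cons k y∈ x≈) = let z , z∈ , y≈az = span-scale⁻ a vs y∈ in
    k · v + z , cons k z∈ refl , trans x≈ (trans (+-cong (sym (*-·-comm a k v)) y≈az) (sym (distribˡ a _ _)))

  *-cancelˡ-≉0 : ¬ x ≈ 0# → x * y ≈ x * z → y ≈ z
  *-cancelˡ-≉0 {x} {y} {z} x≉0 xy≈xz = trans (+-inverseˡ-unique y (- z) (cancel-≉0 x≉0 (trans (distribˡ x y (- z))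
    (trans (+-cong xy≈xz (sym (-‿distribʳ-* x z))) (-‿inverseʳ _))))) (-‿involutive z)

  independent-scale : ∀ {a} → ¬ a ≈ 0# → Independent vs → Independent (map (a *_) vs)
  independent-scale a≉0 [] = []
  independent-scale {a = a} a≉0 (v∉ ∷ vs-indep) = (λ av∈ → let y , y∈ , av≈ay = span-scale⁻ a _ av∈ in
    v∉ (span-resp (sym (*-cancelˡ-≉0 a≉0 av≈ay)) y∈)) ∷ independent-scale a≉0 vs-indep

  scale-space : ∀ {a} → ¬ a ≈ 0# → Space → Space
  scale-space a≉0 V = record { basis-independent = independent-scale a≉0 (basis-independent V) }

  whole : Subspace (c ⊔ c′ ⊔ ℓ₁′)
  whole = record
    { member = λ _ → Level.Lift _ ⊤
    ; resp-≈ = λ _ _ → _ ; 0-closed = _ ; +-closed = λ _ _ → _ ; ·-closed = λ _ _ → _ }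

  wholeSpace : Space
  wholeSpace = proj₁ (toSpace whole λ _ → yes _)

  ∈-whole : ∀ {x} → x ∈ Member wholeSpace
  ∈-whole = proj₂ (proj₂ (toSpace whole λ _ → yes _)) _

  dim-whole : dim wholeSpace ≡ m
  dim-whole = ℕ.≤-antisym (independent⇒≤m (basis-independent wholeSpace)) (spanning⇒m≤ {vs = basis wholeSpace} λ _ → ∈-whole)

  -- Subfields and their stable subspaces

  record Subfield : Set (c ⊔ c′ ⊔ ℓ₁′) where
    field
      space    : Space
      1-closed : 1# ∈ Member space
      *-closed : ∀ {x y} → x ∈ Member space → y ∈ Member space → x * y ∈ Member space

    degree : ℕ
    degree = dim space

    -- Multiplication by x ≉ 0# maps the space injectively into itself, hence onto it by dimension,
    -- so it hits 1#.
    inverse-closed : ∀ {x} → x ∈ Member space → ¬ x ≈ 0# → ∃[ y ] y ∈ Member space × y * x ≈ 1#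
    inverse-closed {x} x∈ x≉0 = let y , y∈ , 1≈xy = span-scale⁻ x (basis space)
                                      (independent-full space (independent-scale x≉0 (basis-independent space)) xH⊆H ℕ.≤-refl 1-closed)
                                in y , y∈ , trans (*-comm y x) (sym 1≈xy)
      where
      xH⊆H : Span (map (x *_) (basis space)) ⊆ Member space
      xH⊆H z∈ = let y , y∈ , z≈xy = span-scale⁻ x (basis space) z∈ in span-resp (sym z≈xy) (*-closed x∈ y∈)

    degree>0 : 0 < degree
    degree>0 = steinitz {vs = 1# ∷ []} ((λ { (nil 1≈0) → 1≉0 1≈0 }) ∷ []) (span⊆ (subspace space) (1-closed ∷ []))

    Stable : Space → Set (c ⊔ c′ ⊔ ℓ₁′)
    Stable V = ∀ {x y} → x ∈ Member space → y ∈ Member V → x * y ∈ Member V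

    -- Replaces bases over H. While some x ∈ V lies outside U, pass to U + Hx. The sum is direct,
    -- since xy ∈ U with y ≉ 0# would give x ∈ U after multiplication by the inverse of y. The first
    -- outcome supplies stable spaces of prescribed dimension, the second shows that dim V is a
    -- multiple of the degree.
    stable-chain : ∀ V → Stable V → ∀ j →
                   (Σ[ U ∈ Space ] Member U ⊆ Member V × Stable U × dim U ≡ j ℕ.* degree) ⊎
                   (∃[ i ] i < j × dim V ≡ i ℕ.* degree)
    stable-chain V V-stable zero = inj₁ (record { basis-independent = [] } ,
      span⊆ (subspace V) [] , (λ { {x} x∈ (nil y≈0) → nil (trans (*-congˡ y≈0) (zeroʳ x)) }) , ≡.refl)
    stable-chain V V-stable (suc j) with stable-chain V V-stable j
    ... | inj₂ (i , i<j , eq) = inj₂ (i , ℕ.m<n⇒m<1+n i<j , eq)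
    ... | inj₁ (U , U⊆V , U-stable , dimU≡) with ⊆span? (subspace V) (member? V) (basis U)
    ...   | inj₁ V⊆U = inj₂ (j , ℕ.n<1+n j , ≡.trans (ℕ.≤-antisym (dim-mono V U V⊆U) (dim-mono U V U⊆V)) dimU≡)
    ...   | inj₂ (x , x∈V , x∉U) = inj₁ (U+Hx , U+Hx⊆V , U+Hx-stable , ≡.cong (degree ℕ.+_) dimU≡)
            where
            x≉0 : ¬ x ≈ 0#
            x≉0 x≈0 = x∉U (span-resp (sym x≈0) span-0)
            disjoint : ∀ {z} → Span (map (x *_) (basis space)) z → Member U z → z ≈ 0#
            disjoint {z} z∈Hx z∈U with span-scale⁻ x (basis space) z∈Hx
            ... | y , y∈H , z≈xy with y ≟ 0#
            ... | yes y≈0 = trans z≈xy (trans (*-congˡ y≈0) (zeroʳ x))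
            ... | no y≉0 = let y⁻¹ , y⁻¹∈H , y⁻¹y≈1 = inverse-closed y∈H y≉0 in
              contradiction (span-resp (trans (*-congˡ (trans z≈xy (*-comm x y)))
                (trans (sym (*-assoc y⁻¹ y x)) (trans (*-congʳ y⁻¹y≈1) (*-identityˡ x)))) (U-stable y⁻¹∈H z∈U)) x∉U
            U+Hx : Space
            U+Hx = record
              { basis = map (x *_) (basis space) ⧺ basis U
              ; basis-independent = independent-disjoint _ (independent-scale x≉0 (basis-independent space)) (basis-independent U) disjoint }
            decompose : ∀ {z} → z ∈ Member U+Hx → ∃[ y ] ∃[ u ] y ∈ Member space × u ∈ Member U × z ≈ x * y + u
            decompose z∈ = let w , u , w∈ , u∈ , z≈w+u = span-++⁻ (map (x *_) (basis space)) z∈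
                               y , y∈ , w≈xy = span-scale⁻ x (basis space) w∈
                           in y , u , y∈ , u∈ , trans z≈w+u (+-congʳ w≈xy)
            U+Hx⊆V : Member U+Hx ⊆ Member V
            U+Hx⊆V z∈ = let y , u , y∈ , u∈ , z≈ = decompose z∈ in
              span-resp (sym z≈) (span-+ (span-resp (*-comm y x) (V-stable y∈ x∈V)) (U⊆V u∈))
            U+Hx-stable : Stable U+Hx
            U+Hx-stable {h} h∈ z∈ = let y , u , y∈ , u∈ , z≈ = decompose z∈ in
              span-resp (sym (trans (*-congˡ z≈) (trans (distribˡ h _ u) (+-congʳ (x∙yz≈y∙xz h x y)))))
                (span-++⁺ (span-scale⁺ x (*-closed h∈ y∈)) (U-stable h∈ u∈))
              where
              x∙yz≈y∙xz : ∀ x y z → x * (y * z) ≈ y * (x * z)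
              x∙yz≈y∙xz x y z = trans (sym (*-assoc x y z)) (trans (*-congʳ (*-comm x y)) (*-assoc y x z))

    degree∣dim : ∀ V → Stable V → degree ∣ dim V
    -- A chain of dim V + 1 steps would outgrow V, because the degree is positive.
    degree∣dim V V-stable with stable-chain V V-stable (suc (dim V))
    ... | inj₂ (i , _ , eq) = divides i eq
    ... | inj₁ (U , U⊆V , _ , dimU≡) = contradiction (dim-mono U V U⊆V)
      (ℕ.<⇒≱ (≡.subst (dim V <_) (≡.sym dimU≡) (ℕ.m≤m*n (suc (dim V)) degree ⦃ ℕ.>-nonZero degree>0 ⦄)))

    degree∣m : degree ∣ m
    degree∣m = ≡.subst (degree ∣_) dim-whole (degree∣dim wholeSpace λ _ _ → ∈-whole)

  -- The Dyson transform

  SmallNondivisor : ℕ → Set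
  SmallNondivisor n = ∃[ d ] 0 < d × d ∣ m × d ≤ n × d ∤ (n ℕ.+ 1)

  -- If sT ⊈ S for some s ∈ S, Dyson's transform (S + sT, T ∩ s⁻¹S) keeps the total
  -- dimension and lowers dim T.  Otherwise T lies in the subfield stabilising S.
  dyson : ∀ {n} f A S T → dim T ≤ f → dim A ≤ n → 1# ∈ Member T → 0 < dim S → n ℕ.+ 2 ≤ dim S ℕ.+ dim T →
          (∀ {x y} → x ∈ Member S → y ∈ Member T → x * y ∈ Member A) → SmallNondivisor n
  dyson zero A S T dimT≤0 _ 1∈T _ _ _ =
    contradiction (ℕ.≤-trans (steinitz {vs = 1# ∷ []} ((λ { (nil 1≈0) → 1≉0 1≈0 }) ∷ []) (span⊆ (subspace T) (1∈T ∷ []))) dimT≤0) λ ()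
  dyson {n} (suc f) A S T dimT≤1+f dimA≤n 1∈T dimS>0 n+2≤ ST⊆A
    with search {P = λ x → x ∈ Member S × (∃[ y ] y ∈ Member T × x * y ∉ Member S)}
           (λ x≈x′ (x∈S , y , y∈T , xy∉S) → span-resp x≈x′ x∈S , y , y∈T , xy∉S ∘ span-resp (*-congʳ (sym x≈x′)))
           (λ x → member? S x ×-dec search (λ y≈y′ (y∈T , xy∉S) → span-resp y≈y′ y∈T , xy∉S ∘ span-resp (*-congˡ (sym y≈y′)))
                                           (λ y → member? T y ×-dec ¬? (member? S (x * y))))
  ... | yes (s , s∈S , t , t∈T , st∉S) = dyson f A S′ T′ (ℕ.≤-pred (ℕ.≤-trans dimT′<dimT dimT≤1+f)) dimA≤n 1∈T′
          (ℕ.≤-trans dimS>0 (dim-mono S S′ S⊆S′)) n+2≤′ S′T′⊆A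
    where
    s≉0 : ¬ s ≈ 0#
    s≉0 s≈0 = st∉S (span-resp (sym (trans (*-congʳ s≈0) (zeroˡ t))) span-0)
    sT = scale-space s≉0 T
    S+sT = toSpace (span (basis S ⧺ basis sT)) (span? _)
    S′ = proj₁ S+sT
    T∩s⁻¹S = toSpace (subspace T ⊓ (s ⁻¹[ subspace S ])) (λ x → member? T x ×-dec member? S (s * x))
    T′ = proj₁ T∩s⁻¹S
    sT′ = scale-space s≉0 T′
    S⊆S′ : Member S ⊆ Member S′
    S⊆S′ x∈ = proj₂ (proj₂ S+sT) (span-++ˡ x∈)
    sT⊆S′ : Member sT ⊆ Member S′
    sT⊆S′ x∈ = proj₂ (proj₂ S+sT) (span-++ʳ (basis S) x∈)
    T′⊆ : Member T′ ⊆ Member T ∩ (λ x → s * x ∈ Member S)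
    T′⊆ = proj₁ (proj₂ T∩s⁻¹S)
    1∈T′ : 1# ∈ Member T′
    1∈T′ = proj₂ (proj₂ T∩s⁻¹S) (1∈T , span-resp (sym (*-identityʳ s)) s∈S)
    -- The element t is lost, since s * t ∉ S.
    dimT′<dimT : dim T′ < dim T
    dimT′<dimT = steinitz {vs = t ∷ basis T′} ((λ t∈T′ → st∉S (proj₂ (T′⊆ t∈T′))) ∷ basis-independent T′)
      (span⊆ (subspace T) (t∈T ∷ span⊆⇒all _ (proj₁ ∘ T′⊆)))
    -- Modularity for S and sT: their sum is S′, and their intersection is sT′.
    dims : dim S ℕ.+ dim T ≤ dim T′ ℕ.+ dim S′
    dims = modular S sT sT′ S′
      (λ x∈ → let y , y∈ , x≈sy = span-scale⁻ s (basis T′) x∈ in span-resp (sym x≈sy) (proj₂ (T′⊆ y∈)))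
      (λ (x∈S , x∈sT) → let y , y∈ , x≈sy = span-scale⁻ s (basis T) x∈sT in
        span-resp (sym x≈sy) (span-scale⁺ s (proj₂ (proj₂ T∩s⁻¹S) (y∈ , span-resp x≈sy x∈S))))
      S⊆S′ sT⊆S′
    n+2≤′ : n ℕ.+ 2 ≤ dim S′ ℕ.+ dim T′
    n+2≤′ = ℕ.≤-trans n+2≤ (ℕ.≤-trans dims (ℕ.≤-reflexive (ℕ.+-comm (dim T′) (dim S′))))
    S′T′⊆A : ∀ {x y} → x ∈ Member S′ → y ∈ Member T′ → x * y ∈ Member A
    -- Write x = u + s z with z ∈ T. Then x y = u y + (s y) z, and s y ∈ S by the choice of T′, so
    -- both terms lie in ST.
    S′T′⊆A {x} {y} x∈ y∈ =
      let u , w , u∈S , w∈sT , x≈u+w = span-++⁻ (basis S) (proj₁ (proj₂ S+sT) x∈)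
          z , z∈T , w≈sz = span-scale⁻ s (basis T) w∈sT
          y∈T , sy∈S = T′⊆ y∈
      in span-resp (sym (trans (*-congʳ (trans x≈u+w (+-congˡ w≈sz))) (trans (distribʳ y u _) (+-congˡ
           (trans (*-assoc s z y) (trans (*-congˡ (*-comm z y)) (sym (*-assoc s y z))))))))
         (span-+ (ST⊆A u∈S y∈T) (ST⊆A sy∈S z∈T))
  ... | no ¬st = degree , degree>0 , degree∣m , degree≤n , degree∤n+1
    where
    ST⊆S : ∀ {x y} → x ∈ Member S → y ∈ Member T → x * y ∈ Member S
    ST⊆S {x} {y} x∈ y∈ = decidable-stable (member? S (x * y)) λ xy∉S → ¬st (x , x∈ , y , y∈ , xy∉S)
    -- Membership is tested on a basis of S only, which makes it decidable.
    stabiliser : Subspace (c ⊔ c′ ⊔ ℓ₁′)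
    stabiliser = record
      { member   = λ x → All (λ y → x * y ∈ Member S) (basis S)
      ; resp-≈   = λ x≈x′ → All.map (span-resp (*-congʳ x≈x′))
      ; 0-closed = All.universal (λ y → span-resp (sym (zeroˡ y)) span-0) (basis S)
      ; +-closed = λ x∈ x′∈ → All.map (λ (xy∈ , x′y∈) → span-resp (sym (distribʳ _ _ _)) (span-+ xy∈ x′y∈)) (All.zip (x∈ , x′∈))
      ; ·-closed = λ k → All.map (λ xy∈ → span-resp (sym (*-assoc _ _ _)) (span-· k xy∈))
      }
    H = toSpace stabiliser (λ x → All.all? (λ y → member? S (x * y)) (basis S))
    stabilises : ∀ {x y} → x ∈ member stabiliser → y ∈ Member S → x * y ∈ Member S
    stabilises {x} x∈ = span⊆ (x ⁻¹[ subspace S ]) x∈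
    stabiliser⁺ : ∀ {x} → (∀ {y} → y ∈ Member S → x * y ∈ Member S) → x ∈ Member (proj₁ H)
    stabiliser⁺ xS⊆S = proj₂ (proj₂ H) (span⊆⇒all (basis S) xS⊆S)
    T⊆H : Member T ⊆ Member (proj₁ H)
    T⊆H t∈ = stabiliser⁺ λ y∈ → span-resp (*-comm _ _) (ST⊆S y∈ t∈)
    H-subfield : Subfield
    H-subfield = record
      { space = proj₁ H
      ; 1-closed = T⊆H 1∈T
      ; *-closed = λ x∈ y∈ → stabiliser⁺ λ z∈ → span-resp (sym (*-assoc _ _ _))
          (stabilises (proj₁ (proj₂ H) x∈) (stabilises (proj₁ (proj₂ H) y∈) z∈))
      }
    open Subfield H-subfield
    dimS≤n : dim S ≤ n
    dimS≤n = ℕ.≤-trans (dim-mono S A λ x∈ → span-resp (*-identityʳ _) (ST⊆A x∈ 1∈T)) dimA≤n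
    degree∣dimS : degree ∣ dim S
    degree∣dimS = degree∣dim S λ x∈ → stabilises (proj₁ (proj₂ H) x∈)
    degree≤n : degree ≤ n
    degree≤n = ℕ.≤-trans (∣⇒≤ ⦃ ℕ.>-nonZero dimS>0 ⦄ degree∣dimS) dimS≤n
    n+2≤dimS+degree : n ℕ.+ 2 ≤ dim S ℕ.+ degree
    n+2≤dimS+degree = ℕ.≤-trans n+2≤ (ℕ.+-monoʳ-≤ (dim S) (dim-mono T (proj₁ H) T⊆H))
    degree∤n+1 : degree ∤ (n ℕ.+ 1)
    -- Both dim S and n + 1 would be multiples of the degree h with dim S < n + 1, so dim S + h ≤ n
    -- + 1, against the lower bound n + 2.
    degree∤n+1 (divides k n+1≡kh) with degree∣dimS
    ... | divides i dimS≡ih = ℕ.<⇒≱ (ℕ.+-monoʳ-< n (ℕ.n<1+n 1)) (begin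
      n ℕ.+ 2              ≤⟨ n+2≤dimS+degree ⟩
      dim S ℕ.+ degree     ≡⟨ ≡.cong (ℕ._+ degree) dimS≡ih ⟩
      i ℕ.* degree ℕ.+ degree  ≡⟨ ℕ.+-comm (i ℕ.* degree) degree ⟩
      suc i ℕ.* degree     ≤⟨ ℕ.*-monoˡ-≤ degree i<k ⟩
      k ℕ.* degree         ≡⟨ n+1≡kh ⟨
      n ℕ.+ 1              ∎)
      where
      open ℕ.≤-Reasoning
      i<k : i < k
      i<k = ℕ.*-cancelʳ-< degree i k (≡.subst₂ _<_ dimS≡ih n+1≡kh
        (ℕ.≤-trans (s≤s dimS≤n) (ℕ.≤-reflexive (ℕ.+-comm 1 n))))

  -- Rado transversals

  ∣p∣+∣q∣≡∣p∪q∣+∣p∩q∣ : ∀ {n} (p q : Subset n) → ∣ p ∣ ℕ.+ ∣ q ∣ ≡ ∣ p ∪ q ∣ ℕ.+ ∣ p ∩ˢ q ∣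
  ∣p∣+∣q∣≡∣p∪q∣+∣p∩q∣ [] [] = ≡.refl
  ∣p∣+∣q∣≡∣p∪q∣+∣p∩q∣ (outside ∷ p) (outside ∷ q) = ∣p∣+∣q∣≡∣p∪q∣+∣p∩q∣ p q
  ∣p∣+∣q∣≡∣p∪q∣+∣p∩q∣ (outside ∷ p) (inside ∷ q)  = ≡.trans (ℕ.+-suc (∣ p ∣) (∣ q ∣)) (≡.cong suc (∣p∣+∣q∣≡∣p∪q∣+∣p∩q∣ p q))
  ∣p∣+∣q∣≡∣p∪q∣+∣p∩q∣ (inside ∷ p)  (outside ∷ q) = ≡.cong suc (∣p∣+∣q∣≡∣p∪q∣+∣p∩q∣ p q)
  ∣p∣+∣q∣≡∣p∪q∣+∣p∩q∣ (inside ∷ p)  (inside ∷ q)  = ≡.cong suc (≡.trans (ℕ.+-suc (∣ p ∣) (∣ q ∣))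
    (≡.trans (≡.cong suc (∣p∣+∣q∣≡∣p∪q∣+∣p∩q∣ p q)) (≡.sym (ℕ.+-suc (∣ p ∪ q ∣) (∣ p ∩ˢ q ∣)))))

  ∈∁⁅⁆⇒≢ : ∀ {n} {i j : Fin n} → j ∈ˢ ∁ ⁅ i ⁆ → j ≢ i
  ∈∁⁅⁆⇒≢ j∈ ≡.refl = Subset.x∈∁p⇒x∉p j∈ (Subset.x∈⁅x⁆ _)

  ≢⇒∈∁⁅⁆ : ∀ {n} {i j : Fin n} → j ≢ i → j ∈ˢ ∁ ⁅ i ⁆
  ≢⇒∈∁⁅⁆ j≢i = Subset.x∉p⇒x∈∁p (j≢i ∘ Subset.x∈⁅y⁆⇒x≡y _)

  ∣∁⁅i⁆∣ : ∀ {n} (i : Fin n) → suc ∣ ∁ ⁅ i ⁆ ∣ ≡ n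
  ∣∁⁅i⁆∣ {suc n} i = ≡.cong suc (≡.trans (Subset.∣∁p∣≡n∸∣p∣ ⁅ i ⁆) (≡.cong (suc n ℕ.∸_) (Subset.∣⁅x⁆∣≡1 i)))

  ∣p∣≤1+∣p∩∁⁅i⁆∣ : ∀ {n} (p : Subset n) i → ∣ p ∣ ≤ suc ∣ p ∩ˢ ∁ ⁅ i ⁆ ∣
  ∣p∣≤1+∣p∩∁⁅i⁆∣ {n} p i = ℕ.+-cancelʳ-≤ ∣ ∁ ⁅ i ⁆ ∣ _ _ (begin
    ∣ p ∣ ℕ.+ ∣ ∁ ⁅ i ⁆ ∣                      ≡⟨ ∣p∣+∣q∣≡∣p∪q∣+∣p∩q∣ p (∁ ⁅ i ⁆) ⟩
    ∣ p ∪ ∁ ⁅ i ⁆ ∣ ℕ.+ ∣ p ∩ˢ ∁ ⁅ i ⁆ ∣       ≤⟨ ℕ.+-monoˡ-≤ _ (Subset.∣p∣≤n (p ∪ ∁ ⁅ i ⁆)) ⟩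
    n ℕ.+ ∣ p ∩ˢ ∁ ⁅ i ⁆ ∣                     ≡⟨ ≡.cong (ℕ._+ ∣ p ∩ˢ ∁ ⁅ i ⁆ ∣) (∣∁⁅i⁆∣ i) ⟨
    suc (∣ ∁ ⁅ i ⁆ ∣ ℕ.+ ∣ p ∩ˢ ∁ ⁅ i ⁆ ∣)     ≡⟨ ≡.cong suc (ℕ.+-comm ∣ ∁ ⁅ i ⁆ ∣ _) ⟩
    suc (∣ p ∩ˢ ∁ ⁅ i ⁆ ∣ ℕ.+ ∣ ∁ ⁅ i ⁆ ∣)     ∎)
    where
    open ℕ.≤-Reasoning

  escape : ∀ V W → dim W < dim V → ∃[ x ] x ∈ Member V × x ∉ Member W
  escape V W dimW<dimV with ⊆span? (subspace V) (member? V) (basis W)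
  ... | inj₁ V⊆W     = contradiction (dim-mono V W V⊆W) (ℕ.<⇒≱ dimW<dimV)
  ... | inj₂ witness = witness

  adjoin : ∀ W {x} → x ∉ Member W → Space
  adjoin W x∉W = record { basis-independent = x∉W ∷ basis-independent W }

  adjoin-∩ : ∀ W {x y} (x∉W : x ∉ Member W) → y ∉ Member (adjoin W x∉W) → ∀ {z} →
             Span (x ∷ basis W) z → Span (y ∷ basis W) z → z ∈ Member W
  adjoin-∩ W x∉W y∉ z∈x (cons k w∈ z≈) = span-resp (sym (trans z≈ (trans (+-congʳ (trans (·-congʳ
    (∉⇒scalar≈0 (subspace (adjoin W x∉W)) y∉ (+-cancelʳ-∈ (subspace (adjoin W x∉W)) (span-∷⁺ _ w∈) (span-resp z≈ z∈x))))
    (·-zeroˡ _))) (+-identityˡ _)))) w∈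

  nonzero-element : ∀ V → 0 < dim V → ∃[ x ] x ∈ Member V × ¬ x ≈ 0#
  nonzero-element record { basis = v ∷ vs ; basis-independent = v∉ ∷ _ } _ =
    v , span-head vs , λ v≈0 → v∉ (span-resp (sym v≈0) span-0)

  dim≤0⇒≈0 : ∀ V → dim V ≤ 0 → ∀ {x} → x ∈ Member V → x ≈ 0#
  dim≤0⇒≈0 record { basis = [] } _ (nil x≈0) = x≈0

  ℕ-+-interchange : ∀ a b c d → (a ℕ.+ b) ℕ.+ (c ℕ.+ d) ≡ (a ℕ.+ c) ℕ.+ (b ℕ.+ d)
  ℕ-+-interchange = ℕ-solve

  suc-+-swap : ∀ a b c → suc a ℕ.+ (b ℕ.+ c) ≡ suc b ℕ.+ (a ℕ.+ c)
  suc-+-swap = ℕ-solve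

  module Transversals (B : Space) where

    -- Taken inside B, so that the empty J yields B itself.
    meetSubspace : Vector Space n → Subset n → Subspace (c ⊔ c′ ⊔ ℓ₁′)
    meetSubspace W J = record
      { member   = λ x → x ∈ Member B × (∀ i → i ∈ˢ J → x ∈ Member (W i))
      ; resp-≈   = λ x≈y (x∈B , x∈W) → span-resp x≈y x∈B , λ i i∈J → span-resp x≈y (x∈W i i∈J)
      ; 0-closed = span-0 , λ _ _ → span-0
      ; +-closed = λ (x∈B , x∈W) (y∈B , y∈W) → span-+ x∈B y∈B , λ i i∈J → span-+ (x∈W i i∈J) (y∈W i i∈J)
      ; ·-closed = λ k (x∈B , x∈W) → span-· k x∈B , λ i i∈J → span-· k (x∈W i i∈J)
      }

    meetSpace : (W : Vector Space n) (J : Subset n) → Σ[ V ∈ Space ] Member V ≐ member (meetSubspace W J)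
    meetSpace W J = toSpace (meetSubspace W J) λ x →
      member? B x ×-dec Fin.all? (λ i → Subset._∈?_ i J →-dec member? (W i) x)

    meet : Vector Space n → Subset n → Space
    meet W J = proj₁ (meetSpace W J)

    meet⁻ : ∀ (W : Vector Space n) J → x ∈ Member (meet W J) → x ∈ Member B × (∀ i → i ∈ˢ J → x ∈ Member (W i))
    meet⁻ W J = proj₁ (proj₂ (meetSpace W J))

    meet⁺ : ∀ (W : Vector Space n) J → x ∈ Member B → (∀ i → i ∈ˢ J → x ∈ Member (W i)) → x ∈ Member (meet W J)
    meet⁺ W J x∈B x∈W = proj₂ (proj₂ (meetSpace W J)) (x∈B , x∈W)

    -- Rado's condition for the annihilators of the W i in the dual of B: those with index in J
    -- together span a space of dimension at least |J|.
    Hall : Vector Space n → Set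
    Hall W = ∀ J → ∣ J ∣ ℕ.+ dim (meet W J) ≤ dim B

    Inside : Vector Space n → Set (c ⊔ c′ ⊔ ℓ₁′)
    Inside W = ∀ i → Member (W i) ⊆ Member B

    _[_]≔_ : Vector Space n → Fin n → Space → Vector Space n
    W [ i ]≔ P = updateAt W i (λ _ → P)

    module _ {n} (W : Vector Space n) (i : Fin n) (P : Space) where

      update⁻-same : Member ((W [ i ]≔ P) i) ⊆ Member P
      update⁻-same {x} = ≡.subst (λ V → x ∈ Member V) (updateAt-updates i W)

      update⁻-other : ∀ {j} → j ≢ i → Member ((W [ i ]≔ P) j) ⊆ Member (W j)
      update⁻-other {j} j≢i {x} = ≡.subst (λ V → x ∈ Member V) (updateAt-minimal j i W j≢i)

      update⁺ : ∀ {p} (Q : Space → Set p) → Q P → (∀ j → j ≢ i → Q (W j)) → ∀ j → Q ((W [ i ]≔ P) j)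
      update⁺ Q QP QW j with j Fin.≟ i
      ... | yes ≡.refl = ≡.subst Q (≡.sym (updateAt-updates i W)) QP
      ... | no j≢i     = ≡.subst Q (≡.sym (updateAt-minimal j i W j≢i)) (QW j j≢i)

      ⊆-update : Member (W i) ⊆ Member P → ∀ j → Member (W j) ⊆ Member ((W [ i ]≔ P) j)
      ⊆-update Wi⊆P j {x} x∈ with j Fin.≟ i
      ... | yes ≡.refl = ≡.subst (λ V → x ∈ Member V) (≡.sym (updateAt-updates i W)) (Wi⊆P x∈)
      ... | no j≢i     = ≡.subst (λ V → x ∈ Member V) (≡.sym (updateAt-minimal j i W j≢i)) x∈

      hall? : Hall (W [ i ]≔ P) ⊎ (∃[ J ] dim B < ∣ J ∣ ℕ.+ dim (meet (W [ i ]≔ P) J))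
      hall? with Subset.anySubset? (λ J → dim B ℕ.<? ∣ J ∣ ℕ.+ dim (meet (W [ i ]≔ P) J))
      ... | yes violation = inj₂ violation
      ... | no hall       = inj₁ λ J → ℕ.≮⇒≥ λ violated → hall (J , violated)

      -- The update affects only the meets over sets that contain i; the other meets keep the bound
      -- of W.
      violation∋i : Hall W → ∀ J → dim B < ∣ J ∣ ℕ.+ dim (meet (W [ i ]≔ P) J) → i ∈ˢ J
      violation∋i hall J violated with Subset._∈?_ i J
      ... | yes i∈J = i∈J
      ... | no i∉J = contradiction (ℕ.≤-trans (ℕ.+-monoʳ-≤ ∣ J ∣ (dim-mono (meet (W [ i ]≔ P) J) (meet W J) λ x∈ →
              let x∈B , x∈W = meet⁻ (W [ i ]≔ P) J x∈ in
              meet⁺ W J x∈B λ j j∈J → update⁻-other (λ { ≡.refl → i∉J j∈J }) (x∈W j j∈J))) (hall J)) (ℕ.<⇒≱ violated)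

    -- W i is the intersection of two larger spaces P and Q; by modularity they
    -- cannot both violate Hall's condition.
    exchange : ∀ (W : Vector Space n) i P Q → Hall W → Member (W i) ⊆ Member P → Member (W i) ⊆ Member Q →
               (∀ {x} → x ∈ Member P → x ∈ Member Q → x ∈ Member (W i)) →
               ∀ J₁ J₂ → dim B < ∣ J₁ ∣ ℕ.+ dim (meet (W [ i ]≔ P) J₁) → ¬ dim B < ∣ J₂ ∣ ℕ.+ dim (meet (W [ i ]≔ Q) J₂)
    exchange W i P Q hall Wi⊆P Wi⊆Q P∩Q⊆Wi J₁ J₂ violated₁ violated₂ = ℕ.<-irrefl ≡.refl (begin-strict
      -- Two violations add up to at least 2b + 2, while the condition for J₁ ∪ J₂ and for J₁ ∩ J₂
      -- without i allows at most 2b + 1.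
      suc (b ℕ.+ b)                                                           <⟨ ℕ.n<1+n _ ⟩
      suc (suc (b ℕ.+ b))                                                     ≡⟨ ≡.cong suc (ℕ.+-suc b b) ⟨
      suc b ℕ.+ suc b                                                         ≤⟨ ℕ.+-mono-≤ violated₁ violated₂ ⟩
      (∣ J₁ ∣ ℕ.+ dim X) ℕ.+ (∣ J₂ ∣ ℕ.+ dim Y)                               ≡⟨ ℕ-+-interchange (∣ J₁ ∣) (dim X) (∣ J₂ ∣) (dim Y) ⟩
      (∣ J₁ ∣ ℕ.+ ∣ J₂ ∣) ℕ.+ (dim X ℕ.+ dim Y)                               ≤⟨ ℕ.+-mono-≤ (ℕ.≤-reflexive (∣p∣+∣q∣≡∣p∪q∣+∣p∩q∣ J₁ J₂)) modularity ⟩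
      (∣ J₁ ∪ J₂ ∣ ℕ.+ ∣ J₁ ∩ˢ J₂ ∣) ℕ.+ (dim I ℕ.+ dim Z)                    ≡⟨ ℕ-+-interchange (∣ J₁ ∪ J₂ ∣) (∣ J₁ ∩ˢ J₂ ∣) (dim I) (dim Z) ⟩
      (∣ J₁ ∪ J₂ ∣ ℕ.+ dim I) ℕ.+ (∣ J₁ ∩ˢ J₂ ∣ ℕ.+ dim Z)                    ≤⟨ ℕ.+-mono-≤ (hall (J₁ ∪ J₂)) (ℕ.+-monoˡ-≤ (dim Z) (∣p∣≤1+∣p∩∁⁅i⁆∣ (J₁ ∩ˢ J₂) i)) ⟩
      b ℕ.+ suc (∣ (J₁ ∩ˢ J₂) ∩ˢ ∁ ⁅ i ⁆ ∣ ℕ.+ dim Z)                         ≤⟨ ℕ.+-monoʳ-≤ b (s≤s (hall ((J₁ ∩ˢ J₂) ∩ˢ ∁ ⁅ i ⁆))) ⟩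
      b ℕ.+ suc b                                                             ≡⟨ ℕ.+-suc b b ⟩
      suc (b ℕ.+ b)                                                           ∎)
      where
      open ℕ.≤-Reasoning
      b = dim B
      X = meet (W [ i ]≔ P) J₁
      Y = meet (W [ i ]≔ Q) J₂
      I = meet W (J₁ ∪ J₂)
      -- The index i is left out because the updated families agree with W only away from i.
      Z = meet W ((J₁ ∩ˢ J₂) ∩ˢ ∁ ⁅ i ⁆)
      X∩Y⊆I : Member X ∩ Member Y ⊆ Member I
      X∩Y⊆I {x} (x∈X , x∈Y) = meet⁺ W (J₁ ∪ J₂) (proj₁ X⁻) x∈W
        where
        X⁻ = meet⁻ (W [ i ]≔ P) J₁ x∈X
        Y⁻ = meet⁻ (W [ i ]≔ Q) J₂ x∈Y
        x∈W : ∀ j → j ∈ˢ J₁ ∪ J₂ → x ∈ Member (W j)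
        x∈W j j∈ with j Fin.≟ i
        ... | yes ≡.refl = P∩Q⊆Wi (update⁻-same W i P (proj₂ X⁻ i (violation∋i W i P hall J₁ violated₁)))
                                  (update⁻-same W i Q (proj₂ Y⁻ i (violation∋i W i Q hall J₂ violated₂)))
        ... | no j≢i with Subset.x∈p∪q⁻ J₁ J₂ j∈
        ... | inj₁ j∈J₁ = update⁻-other W i P j≢i (proj₂ X⁻ j j∈J₁)
        ... | inj₂ j∈J₂ = update⁻-other W i Q j≢i (proj₂ Y⁻ j j∈J₂)
      modularity : dim X ℕ.+ dim Y ≤ dim I ℕ.+ dim Z
      modularity = modular X Y I Z
        (λ x∈ → let x∈B , x∈W = meet⁻ W (J₁ ∪ J₂) x∈ in
          meet⁺ (W [ i ]≔ P) J₁ x∈B λ j j∈J₁ → ⊆-update W i P Wi⊆P j (x∈W j (Subset.x∈p∪q⁺ (inj₁ j∈J₁))))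
        X∩Y⊆I
        (λ x∈ → let x∈B , x∈W = meet⁻ (W [ i ]≔ P) J₁ x∈ in
          meet⁺ W ((J₁ ∩ˢ J₂) ∩ˢ ∁ ⁅ i ⁆) x∈B λ j j∈ → let j∈J₁₂ , j∈∁i = Subset.x∈p∩q⁻ (J₁ ∩ˢ J₂) (∁ ⁅ i ⁆) j∈ in
            update⁻-other W i P (∈∁⁅⁆⇒≢ j∈∁i) (x∈W j (proj₁ (Subset.x∈p∩q⁻ J₁ J₂ j∈J₁₂))))
        (λ x∈ → let x∈B , x∈W = meet⁻ (W [ i ]≔ Q) J₂ x∈ in
          meet⁺ W ((J₁ ∩ˢ J₂) ∩ˢ ∁ ⁅ i ⁆) x∈B λ j j∈ → let j∈J₁₂ , j∈∁i = Subset.x∈p∩q⁻ (J₁ ∩ˢ J₂) (∁ ⁅ i ⁆) j∈ in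
            update⁻-other W i Q (∈∁⁅⁆⇒≢ j∈∁i) (x∈W j (proj₂ (Subset.x∈p∩q⁻ J₁ J₂ j∈J₁₂))))

    -- For a member of a family inside B this is codimension at most one; `Hall` on a singleton
    -- excludes B itself, which leaves a hyperplane.
    Saturated : Space → Set
    Saturated V = dim B ≤ suc (dim V)

    record Enlargement {n} (W : Vector Space n) : Set (c ⊔ c′ ⊔ ℓ₁′) where
      field
        family : Vector Space n
        ⊇      : ∀ i → Member (W i) ⊆ Member (family i)
        in-B   : Inside family
        hall   : Hall family

    open Enlargement

    -- Codimension at least two leaves room for two directions x and y independent modulo W i. The
    -- spaces W i + Kx and W i + Ky meet in W i, so by `exchange` one of them can replace W i.
    enlarge : ∀ (W : Vector Space n) → Inside W → Hall W → ∀ i → ¬ Saturated (W i) →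
              Σ[ W′ ∈ Enlargement W ] dim (W i) < dim (family W′ i)
    enlarge W W⊆B W-hall i unsaturated = choose (hall? W i P) (hall? W i Q)
      where
      1+d<b : suc (dim (W i)) < dim B
      1+d<b = ℕ.≰⇒> unsaturated
      x∃ = escape B (W i) (ℕ.<-trans (ℕ.n<1+n _) 1+d<b)
      x∉ = proj₂ (proj₂ x∃)
      P = adjoin (W i) x∉
      y∃ = escape B P 1+d<b
      y∉W : proj₁ y∃ ∉ Member (W i)
      y∉W = proj₂ (proj₂ y∃) ∘ span-∷⁺ _
      Q = adjoin (W i) y∉W
      enlarge-to : ∀ {z} (z∉ : z ∉ Member (W i)) → z ∈ Member B → Hall (W [ i ]≔ adjoin (W i) z∉) →
                   Σ[ W′ ∈ Enlargement W ] dim (W i) < dim (family W′ i)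
      enlarge-to {z} z∉ z∈B R-hall = record
        { family = W [ i ]≔ R
        ; ⊇      = ⊆-update W i R (span-∷⁺ z)
        ; in-B   = λ j {x} → update⁺ W i R (λ V → Member V ⊆ Member B) R⊆B (λ j _ → W⊆B j) j
        ; hall   = R-hall
        } , ≡.subst (λ V → dim (W i) < dim V) (≡.sym (updateAt-updates i W)) (ℕ.n<1+n _)
        where
        R = adjoin (W i) z∉
        R⊆B : Member R ⊆ Member B
        R⊆B = span⊆ (subspace B) (z∈B ∷ span⊆⇒all _ (W⊆B i))
      choose : _ → _ → Σ[ W′ ∈ Enlargement W ] dim (W i) < dim (family W′ i)
      choose (inj₁ P-hall) _ = enlarge-to x∉ (proj₁ (proj₂ x∃)) P-hall
      choose (inj₂ _) (inj₁ Q-hall) = enlarge-to y∉W (proj₁ (proj₂ y∃)) Q-hall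
      choose (inj₂ (J₁ , violated₁)) (inj₂ (J₂ , violated₂)) = contradiction violated₂
        (exchange W i P Q W-hall (span-∷⁺ _) (span-∷⁺ _) (adjoin-∩ (W i) x∉ (proj₂ (proj₂ y∃))) J₁ J₂ violated₁)

    enlargement-refl : ∀ {W : Vector Space n} → Inside W → Hall W → Enlargement W
    enlargement-refl {W = W} W⊆B W-hall = record { family = W ; ⊇ = λ _ x∈ → x∈ ; in-B = W⊆B ; hall = W-hall }

    enlargement-trans : ∀ {W : Vector Space n} (W′ : Enlargement W) → Enlargement (family W′) → Enlargement W
    enlargement-trans W′ W″ = record { family = family W″ ; ⊇ = λ i → ⊇ W″ i ∘ ⊇ W′ i ; in-B = in-B W″ ; hall = hall W″ }

    saturate-at : ∀ f (W : Vector Space n) → Inside W → Hall W → ∀ i → dim B ≤ f ℕ.+ suc (dim (W i)) →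
                  Σ[ W′ ∈ Enlargement W ] Saturated (family W′ i)
    saturate-at zero W W⊆B W-hall i saturated = enlargement-refl W⊆B W-hall , saturated
    saturate-at (suc f) W W⊆B W-hall i b≤ with dim B ℕ.≤? suc (dim (W i))
    ... | yes saturated = enlargement-refl W⊆B W-hall , saturated
    ... | no unsaturated =
      let W′ , d<d′ = enlarge W W⊆B W-hall i unsaturated
          W″ , saturated = saturate-at f (family W′) (in-B W′) (hall W′) i
            (ℕ.≤-trans b≤ (ℕ.≤-trans (ℕ.≤-reflexive (≡.sym (ℕ.+-suc f _))) (ℕ.+-monoʳ-≤ f (s≤s d<d′))))
      in enlargement-trans W′ W″ , saturated

    saturate : ∀ (W : Vector Space n) → Inside W → Hall W → (is : List (Fin n)) →
               Σ[ W′ ∈ Enlargement W ] ListAll.All (λ i → Saturated (family W′ i)) is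
    saturate W W⊆B W-hall [] = enlargement-refl W⊆B W-hall , ListAll.[]
    saturate W W⊆B W-hall (i ∷ is) =
      let W′ , saturated-is = saturate W W⊆B W-hall is
          W″ , saturated-i = saturate-at (dim B) (family W′) (in-B W′) (hall W′) i (ℕ.m≤m+n _ _)
      in enlargement-trans W′ W″ , saturated-i ListAll.∷
         ListAll.map (λ {j} b≤ → ℕ.≤-trans b≤ (s≤s (dim-mono (family W′ j) (family W″ j) (⊇ W″ j)))) saturated-is

    -- By modularity, each further space of codimension at most one lowers the dimension of the meet
    -- by at most one.
    codimension : ∀ {n} (W : Vector Space n) → Inside W → (∀ i → Saturated (W i)) → ∀ J → dim B ≤ ∣ J ∣ ℕ.+ dim (meet W J)
    codimension W _ _ [] = dim-mono B (meet W []) λ x∈B → meet⁺ W [] x∈B λ ()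
    codimension W W⊆B W-saturated (outside ∷ J) = ℕ.≤-trans (codimension (W ∘ suc) (W⊆B ∘ suc) (W-saturated ∘ suc) J)
      (ℕ.+-monoʳ-≤ ∣ J ∣ (dim-mono (meet (W ∘ suc) J) (meet W (outside ∷ J)) λ x∈ → let x∈B , x∈W = meet⁻ (W ∘ suc) J x∈ in
        meet⁺ W (outside ∷ J) x∈B λ { (suc i) (there i∈J) → x∈W i i∈J }))
    codimension W W⊆B W-saturated (inside ∷ J) = ℕ.+-cancelʳ-≤ b _ _ (begin
      b ℕ.+ b                                        ≤⟨ ℕ.+-mono-≤ (W-saturated zero) (codimension (W ∘ suc) (W⊆B ∘ suc) (W-saturated ∘ suc) J) ⟩
      suc (dim (W zero)) ℕ.+ (∣ J ∣ ℕ.+ dim Y)       ≡⟨ suc-+-swap (dim (W zero)) (∣ J ∣) (dim Y) ⟩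
      suc ∣ J ∣ ℕ.+ (dim (W zero) ℕ.+ dim Y)         ≤⟨ ℕ.+-monoʳ-≤ (suc ∣ J ∣) modularity ⟩
      suc ∣ J ∣ ℕ.+ (dim I ℕ.+ b)                    ≡⟨ ℕ.+-assoc (suc ∣ J ∣) (dim I) b ⟨
      suc ∣ J ∣ ℕ.+ dim I ℕ.+ b                      ∎)
      where
      open ℕ.≤-Reasoning
      b = dim B
      Y = meet (W ∘ suc) J
      I = meet W (inside ∷ J)
      modularity : dim (W zero) ℕ.+ dim Y ≤ dim I ℕ.+ b
      modularity = modular (W zero) Y I B
        (λ x∈ → proj₂ (meet⁻ W (inside ∷ J) x∈) zero here)
        (λ (x∈W₀ , x∈Y) → let x∈B , x∈W = meet⁻ (W ∘ suc) J x∈Y in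
          meet⁺ W (inside ∷ J) x∈B λ { zero _ → x∈W₀ ; (suc i) (there i∈J) → x∈W i i∈J })
        (W⊆B zero)
        (λ x∈ → proj₁ (meet⁻ (W ∘ suc) J x∈))

    linearCombination-remove : ∀ {n} (k : Vector K.Carrier (suc n)) (b : Vector Carrier (suc n)) i →
      linearCombination k b ≈ k i · b i + linearCombination (removeAt k i) (removeAt b i)
    linearCombination-remove k b i = sum-remove {i = i} (λ j → k j · b j)

    Transversal : Vector Space n → Vector Carrier n → Set (c ⊔ ℓ₁ ⊔ c′ ⊔ ℓ₁′)
    Transversal W b = LinearlyIndependent b × (∀ i → b i ∈ Member B) ×
      (∀ {x} → x ∈ Member B → ∃[ k ] x ≈ linearCombination k b) ×
      (∀ i {x} → x ∈ Member (W i) → x ∈ ⟨ entriesExcept i b ⟩)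

    -- The W i are hyperplanes of B with zero intersection, and b i spans the line
    -- in which the others meet.
    hyperplane-transversal : ∀ {n} → dim B ≡ n → (W : Vector Space n) → Inside W → Hall W → (∀ i → Saturated (W i)) →
                             ∃[ b ] Transversal W b
    hyperplane-transversal {zero} b≡0 W W⊆B W-hall _ = (λ ()) , (λ _ _ ()) , (λ ()) ,
      (λ x∈B → (λ ()) , dim≤0⇒≈0 B (ℕ.≤-reflexive b≡0) x∈B) , λ ()
    hyperplane-transversal {n@(suc _)} b≡n W W⊆B W-hall W-saturated = b , b-independent , b∈B , b-spans , W⊆except
      where
      line : Fin n → Space
      line i = meet W (∁ ⁅ i ⁆)
      dim-line : ∀ i → 0 < dim (line i)
      dim-line i = ℕ.+-cancelˡ-≤ ∣ ∁ ⁅ i ⁆ ∣ _ _ (ℕ.≤-trans (ℕ.≤-reflexive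
        (≡.trans (ℕ.+-comm ∣ ∁ ⁅ i ⁆ ∣ 1) (≡.trans (∣∁⁅i⁆∣ i) (≡.sym b≡n))))
        (codimension W W⊆B W-saturated (∁ ⁅ i ⁆)))
      b∃ : ∀ i → ∃[ x ] x ∈ Member (line i) × ¬ x ≈ 0#
      b∃ i = nonzero-element (line i) (dim-line i)
      b : Vector Carrier n
      b i = proj₁ (b∃ i)
      b∈line : ∀ i → b i ∈ Member B × (∀ j → j ∈ˢ ∁ ⁅ i ⁆ → b i ∈ Member (W j))
      b∈line i = meet⁻ W (∁ ⁅ i ⁆) (proj₁ (proj₂ (b∃ i)))
      b∈B : ∀ i → b i ∈ Member B
      b∈B i = proj₁ (b∈line i)
      dim-meet-⊤ : dim (meet W ⊤ˢ) ≤ 0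
      dim-meet-⊤ = ℕ.+-cancelˡ-≤ n _ _ (ℕ.≤-trans (ℕ.≤-trans (ℕ.≤-reflexive (≡.cong (ℕ._+ dim (meet W ⊤ˢ)) (≡.sym (Subset.∣⊤∣≡n n))))
        (W-hall ⊤ˢ)) (ℕ.≤-reflexive (≡.trans b≡n (≡.sym (ℕ.+-identityʳ n)))))
      b∉W : ∀ i → b i ∉ Member (W i)
      b∉W i bi∈Wi = proj₂ (proj₂ (b∃ i)) (dim≤0⇒≈0 (meet W ⊤ˢ) dim-meet-⊤ (meet⁺ W ⊤ˢ (b∈B i) λ j _ → bi∈W j))
        where
        bi∈W : ∀ j → b i ∈ Member (W j)
        bi∈W j with j Fin.≟ i
        ... | yes ≡.refl = bi∈Wi
        ... | no j≢i = proj₂ (b∈line i) j (≢⇒∈∁⁅⁆ j≢i)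
      rest∈W : ∀ i k → linearCombination k (removeAt b i) ∈ Member (W i)
      rest∈W i k = linearCombination-closed (subspace (W i)) k (removeAt b i) λ j →
        proj₂ (b∈line (punchIn i j)) i (≢⇒∈∁⁅⁆ (Fin.punchInᵢ≢i i j ∘ ≡.sym))
      -- All basis vectors except b i lie in W i, so W i lies in the kernel of the i-th coordinate.
      coordinate≈0 : ∀ k i → linearCombination k b ∈ Member (W i) → k i K.≈ K.0#
      coordinate≈0 k i lc∈ = ∉⇒scalar≈0 (subspace (W i)) (b∉W i)
        (+-cancelʳ-∈ (subspace (W i)) (rest∈W i (removeAt k i)) (span-resp (linearCombination-remove k b i) lc∈))
      b-independent : LinearlyIndependent b
      b-independent k lc≈0 i = coordinate≈0 k i (span-resp (sym lc≈0) span-0)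
      b-spans : ∀ {x} → x ∈ Member B → ∃[ k ] x ≈ linearCombination k b
      b-spans x∈B = span-tabulate-coefficients b (independent-full B (linearlyIndependent⇒independent b b-independent)
        (span⊆ (subspace B) (all-tabulate b b∈B)) (ℕ.≤-reflexive b≡n) x∈B)
      W⊆except : ∀ i {x} → x ∈ Member (W i) → x ∈ ⟨ entriesExcept i b ⟩
      W⊆except i x∈W =
        let k , x≈ = b-spans (W⊆B i x∈W)
            kᵢ≈0 = coordinate≈0 k i (span-resp x≈ x∈W)
        in _ , removeAt b i , removeAt k i , (λ j → punchIn i j , Fin.punchInᵢ≢i i j , refl) ,
           trans x≈ (trans (linearCombination-remove k b i) (trans (+-congʳ (trans (·-congʳ kᵢ≈0) (·-zeroˡ _))) (+-identityˡ _)))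

    transversal : ∀ {n} → dim B ≡ n → (W : Vector Space n) → Inside W → Hall W → ∃[ b ] Transversal W b
    transversal b≡n W W⊆B W-hall =
      let W′ , saturated = saturate W W⊆B W-hall (allFin _)
          b , b-independent , b∈B , b-spans , W′⊆except =
            hyperplane-transversal b≡n (family W′) (in-B W′) (hall W′) λ j → ListAll.lookup saturated (∈-allFin j)
      in b , b-independent , b∈B , b-spans , λ i → W′⊆except i ∘ ⊇ W′ i

  -- Matchable pairs

  select : (v : Vector Carrier n) (J : Subset n) → Vec Carrier ∣ J ∣
  select v []            = []
  select v (outside ∷ J) = select (v ∘ suc) J
  select v (inside ∷ J)  = v zero ∷ select (v ∘ suc) J

  all-select : ∀ {P : Pred Carrier p} (v : Vector Carrier n) J → (∀ i → i ∈ˢ J → P (v i)) → All P (select v J)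
  all-select v []            Pv = []
  all-select v (outside ∷ J) Pv = all-select (v ∘ suc) J (λ i i∈J → Pv (suc i) (there i∈J))
  all-select v (inside ∷ J)  Pv = Pv zero here ∷ all-select (v ∘ suc) J (λ i i∈J → Pv (suc i) (there i∈J))

  select-independent : ∀ (v : Vector Carrier n) J → Independent (tabulate v) → Independent (select v J)
  select-independent v []            _                = []
  select-independent v (outside ∷ J) (_ ∷ v-indep)    = select-independent (v ∘ suc) J v-indep
  select-independent v (inside ∷ J)  (v₀∉ ∷ v-indep)  =
    (λ v₀∈ → v₀∉ (span⊆ (span _) (all-select (v ∘ suc) J λ i _ → span-tabulate (v ∘ suc) i) v₀∈))
    ∷ select-independent (v ∘ suc) J v-indep

  basisSpace : ∀ {v : Vector Carrier n} (V : Subspace p) → IsOrderedBasis v V → Space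
  basisSpace {v = v} V v-basis = record { basis = tabulate v ; basis-independent = orderedBasis⇒independent V v-basis }

  matchable : ∀ {n} (A B : Subspace p) → HasDimension B n → 1# ∉ member B → ¬ SmallNondivisor n → Matchable n A B
  matchable {n = n} A B (b₀ , b₀-basis) 1∉B no-divisor a a-basis =
    let b , b-independent , b∈B , b-spans , W⊆except = transversal ≡.refl W W⊆B W-hall in
    b , orderedBasis B b-independent (λ i → Bˢ⊆B (b∈B i)) (λ x∈B → b-spans (B⊆Bˢ x∈B)) ,
    λ i {x} ((a⁻¹ , a⁻¹a≈1 , y , y∈A , x≈a⁻¹y) , x∈B) → W⊆except i (W⁺ i (B⊆Bˢ x∈B)
      (A⊆Aˢ (Subspace.resp-≈ A (aa⁻¹y≈y a⁻¹a≈1 x≈a⁻¹y) y∈A)))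
    where
    Aˢ = basisSpace A a-basis
    Bˢ = basisSpace B b₀-basis
    A⊆Aˢ : member A ⊆ Member Aˢ
    A⊆Aˢ = proj₂ (orderedBasis⇒span A a-basis)
    Bˢ⊆B : Member Bˢ ⊆ member B
    Bˢ⊆B = proj₁ (orderedBasis⇒span B b₀-basis)
    B⊆Bˢ : member B ⊆ Member Bˢ
    B⊆Bˢ = proj₂ (orderedBasis⇒span B b₀-basis)
    open Transversals Bˢ
    aa⁻¹y≈y : ∀ {a a⁻¹ x y} → a⁻¹ * a ≈ 1# → x ≈ a⁻¹ * y → y ≈ a * x
    aa⁻¹y≈y {a} {a⁻¹} {x} {y} a⁻¹a≈1 x≈a⁻¹y = sym (trans (*-congˡ x≈a⁻¹y) (trans (sym (*-assoc a a⁻¹ y))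
      (trans (*-congʳ (trans (*-comm a a⁻¹) a⁻¹a≈1)) (*-identityˡ y))))
    -- The space (a i)⁻¹A ∩ B, written without the inverse.
    W∃ : ∀ i → Σ[ V ∈ Space ] Member V ≐ member (subspace Bˢ ⊓ (a i ⁻¹[ subspace Aˢ ]))
    W∃ i = toSpace (subspace Bˢ ⊓ (a i ⁻¹[ subspace Aˢ ])) λ x → member? Bˢ x ×-dec member? Aˢ (a i * x)
    W : Vector Space n
    W i = proj₁ (W∃ i)
    W⁺ : ∀ i {x} → x ∈ Member Bˢ → a i * x ∈ Member Aˢ → x ∈ Member (W i)
    W⁺ i x∈B ax∈A = proj₂ (proj₂ (W∃ i)) (x∈B , ax∈A)
    W⊆B : Inside W
    W⊆B i x∈ = proj₁ (proj₁ (proj₂ (W∃ i)) x∈)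
    aW⊆A : ∀ i {x} → x ∈ Member (W i) → a i * x ∈ Member Aˢ
    aW⊆A i x∈ = proj₂ (proj₁ (proj₂ (W∃ i)) x∈)
    -- A violating J makes ⟨a j : j ∈ J⟩ and K ⊕ ⋂ W j too large for their product to lie in A.
    W-hall : Hall W
    W-hall J = ℕ.≮⇒≥ λ violated → no-divisor
      (dyson (dim T) Aˢ S T ℕ.≤-refl ℕ.≤-refl (span-head _) (S>0 violated) (dims violated) ST⊆A)
      where
      -- This is where 1 ∉ B enters: adjoining 1# raises the dimension by one, which turns n + 1
      -- into n + 2.
      1∉meet : 1# ∉ Member (meet W J)
      1∉meet 1∈ = 1∉B (Bˢ⊆B (proj₁ (meet⁻ W J 1∈)))
      T = adjoin (meet W J) 1∉meet
      S : Space
      S = record { basis = select a J ; basis-independent = select-independent a J (basis-independent Aˢ) }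
      -- The empty J cannot violate the condition, because the meet lies in B.
      S>0 : n < ∣ J ∣ ℕ.+ dim (meet W J) → 0 < ∣ J ∣
      S>0 violated = ℕ.≰⇒> λ ∣J∣≤0 → ℕ.<⇒≱ violated (ℕ.≤-trans (ℕ.+-monoˡ-≤ _ ∣J∣≤0)
        (dim-mono (meet W J) Bˢ λ x∈ → proj₁ (meet⁻ W J x∈)))
      dims : n < ∣ J ∣ ℕ.+ dim (meet W J) → n ℕ.+ 2 ≤ ∣ J ∣ ℕ.+ suc (dim (meet W J))
      dims violated = ℕ.≤-trans (ℕ.≤-reflexive (ℕ.+-comm n 2))
        (ℕ.≤-trans (s≤s violated) (ℕ.≤-reflexive (≡.sym (ℕ.+-suc ∣ J ∣ _))))
      aT⊆A : ∀ i → i ∈ˢ J → ∀ {y} → y ∈ Member T → a i * y ∈ Member Aˢ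
      aT⊆A i i∈J = span⊆ (a i ⁻¹[ subspace Aˢ ])
        (span-resp (sym (*-identityʳ (a i))) (span-tabulate a i) ∷ span⊆⇒all _ λ x∈ → aW⊆A i (proj₂ (meet⁻ W J x∈) i i∈J))
      ST⊆A : ∀ {x y} → x ∈ Member S → y ∈ Member T → x * y ∈ Member Aˢ
      ST⊆A {x} {y} x∈S y∈T = span-resp (*-comm y x) (span⊆ (y ⁻¹[ subspace Aˢ ])
        (all-select a J λ i i∈J → span-resp (*-comm (a i) y) (aT⊆A i i∈J y∈T)) x∈S)

  -- Unmatchable pairs from a subfield

  open CommutativeExp commutativeSemiring
  private
    module ^ᴷ = CommutativeExp (CommutativeRing.commutativeSemiring (ringOf K))
  open Polynomial L card-L
  open Mult +-monoid using () renaming (_×_ to _×#_)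

  embed-^ : ∀ k r → embed (k ^ᴷ.^ r) ≈ embed k ^ r
  embed-^ k zero    = 1#-homo
  embed-^ k (suc r) = trans (*-homo k _) (*-congˡ (embed-^ k r))

  1^ : ∀ r → 1# ^ r ≈ 1#
  1^ zero    = refl
  1^ (suc r) = trans (*-identityˡ _) (1^ r)

  -- Iterates k^q = k in K. Scalars therefore pass through the map x ↦ x^(q^r), which is K-linear.
  embed-^q^ : ∀ k r → embed k ^ (q ℕ.^ r) ≈ embed k
  embed-^q^ k zero    = *-identityʳ _
  embed-^q^ k (suc r) = trans (sym (^-assocʳ (embed k) q (q ℕ.^ r)))
    (trans (^-congˡ (q ℕ.^ r) (trans (sym (embed-^ k q)) (⟦⟧-cong (K.fermat k)))) (embed-^q^ k r))

  -- The span has q^r distinct elements, all of them roots of a polynomial of degree q^s.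
  roots-dim : ∀ {r s f} {vs : Vec Carrier r} → Monic (q ℕ.^ s) f → Independent {r} vs → (∀ {x} → Span vs x → f x ≈ 0#) → r ≤ s
  roots-dim {vs = vs} f-monic vs-indep roots = q^-cancel-≤ (roots≤degree f-monic (decode vs) (decode-injective vs-indep)
    λ i → roots (linearCombination∈span vs _))

  -- The subfield of degree d as a fixed field

  module FrobeniusPower {ch j} (ch-prime : Prime ch) (q≡ : q ≡ ch ℕ.^ j) where

    ch≈0 : ch ×# 1# ≈ 0#
    ch≈0 = characteristic (j ℕ.* m) (≡.trans (≡.cong (ℕ._^ m) q≡) (ℕ.^-*-assoc ch j m))

    frobenius-+ : ∀ r x y → (x + y) ^ (q ℕ.^ r) ≈ x ^ (q ℕ.^ r) + y ^ (q ℕ.^ r)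
    frobenius-+ r x y = ≡.subst (λ Q → (x + y) ^ Q ≈ x ^ Q + y ^ Q)
      (≡.sym (≡.trans (≡.cong (ℕ._^ r) q≡) (ℕ.^-*-assoc ch j r))) (Frobenius.+-^ ch-prime ch≈0 (j ℕ.* r) x y)

    frobenius-· : ∀ r k x → (k · x) ^ (q ℕ.^ r) ≈ k · x ^ (q ℕ.^ r)
    frobenius-· r k x = trans (^-distrib-* (embed k) x (q ℕ.^ r)) (*-congʳ (embed-^q^ k r))

    0^q^ : ∀ r → 0# ^ (q ℕ.^ r) ≈ 0#
    0^q^ r = trans (^-congˡ (q ℕ.^ r) (sym (·-zeroˡ 0#))) (trans (frobenius-· r K.0# 0#) (·-zeroˡ _))

    module FixedField (d : ℕ) (d>0 : 0 < d) where

      fixed : Subspace ℓ₁′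
      fixed = record
        { member   = λ x → x ^ (q ℕ.^ d) ≈ x
        ; resp-≈   = λ x≈y xQ≈x → trans (^-congˡ (q ℕ.^ d) (sym x≈y)) (trans xQ≈x x≈y)
        ; 0-closed = 0^q^ d
        ; +-closed = λ xQ≈x yQ≈y → trans (frobenius-+ d _ _) (+-cong xQ≈x yQ≈y)
        ; ·-closed = λ k xQ≈x → trans (frobenius-· d k _) (·-congˡ k xQ≈x)
        }

      fixedSpace : Σ[ V ∈ Space ] Member V ≐ member fixed
      fixedSpace = toSpace fixed λ x → x ^ (q ℕ.^ d) ≟ x

      fixed⁻ : ∀ {x} → x ∈ Member (proj₁ fixedSpace) → x ^ (q ℕ.^ d) ≈ x
      fixed⁻ = proj₁ (proj₂ fixedSpace)

      fixed⁺ : ∀ {x} → x ^ (q ℕ.^ d) ≈ x → x ∈ Member (proj₁ fixedSpace)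
      fixed⁺ = proj₂ (proj₂ fixedSpace)

      fixedField : Subfield
      fixedField = record
        { space    = proj₁ fixedSpace
        ; 1-closed = fixed⁺ (1^ (q ℕ.^ d))
        ; *-closed = λ x∈ y∈ → fixed⁺ (trans (^-distrib-* _ _ (q ℕ.^ d)) (*-cong (fixed⁻ x∈) (fixed⁻ y∈)))
        }

      open Subfield fixedField using (space; degree)

      -- The elements are roots of x^(q^d) - x; the term - x has lower degree because 1 < q^d.
      degree≤d : degree ≤ d
      degree≤d = roots-dim (monic-+ (degree<-negated 1<Q) (monic-^ (q ℕ.^ d))) (basis-independent space)
        λ x∈ → trans (+-congˡ (fixed⁻ x∈)) (-‿inverseˡ _)
        where
        1<Q : 1 < q ℕ.^ d
        1<Q = ℕ.≤-trans 1<q (≡.subst (_≤ q ℕ.^ d) (ℕ.^-identityʳ q) (ℕ.^-monoʳ-≤ q ⦃ ℕ.>-nonZero (ℕ.<-trans (s≤s z≤n) 1<q) ⦄ d>0))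

      -- The sum of x^(q^(id)) over i < e. For e = m / d it is the trace from L to the fixed field.
      trace : ℕ → Carrier → Carrier
      trace zero    x = 0#
      trace (suc e) x = trace e x + x ^ (q ℕ.^ (e ℕ.* d))

      trace-cong : ∀ e {x y} → x ≈ y → trace e x ≈ trace e y
      trace-cong zero    x≈y = refl
      trace-cong (suc e) x≈y = +-cong (trace-cong e x≈y) (^-congˡ (q ℕ.^ (e ℕ.* d)) x≈y)

      trace-+ : ∀ e x y → trace e (x + y) ≈ trace e x + trace e y
      trace-+ zero    x y = sym (+-identityˡ 0#)
      trace-+ (suc e) x y = trans (+-cong (trace-+ e x y) (frobenius-+ (e ℕ.* d) x y)) (+-interchange _ _ _ _)

      trace-· : ∀ e k x → trace e (k · x) ≈ k · trace e x
      trace-· zero    k x = sym (·-zeroʳ k)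
      trace-· (suc e) k x = trans (+-cong (trace-· e k x) (frobenius-· (e ℕ.* d) k x)) (sym (·-distribˡ k _ _))

      trace-0 : ∀ e → trace e 0# ≈ 0#
      trace-0 e = trans (trace-cong e (sym (·-zeroˡ 0#))) (trans (trace-· e K.0# 0#) (·-zeroˡ _))

      -- Raising to the power q^d moves each summand to the next, so only the two ends differ; x is
      -- put on the left to avoid a subtraction.
      trace-telescope : ∀ e x → trace e x ^ (q ℕ.^ d) + x ≈ trace e x + x ^ (q ℕ.^ (e ℕ.* d))
      trace-telescope zero x = +-cong (0^q^ d) (sym (*-identityʳ x))
      trace-telescope (suc e) x = begin
        (trace e x + xᴱ) ^ Q + x       ≈⟨ +-congʳ (frobenius-+ d _ _) ⟩
        trace e x ^ Q + xᴱ ^ Q + x     ≈⟨ trans (+-congʳ (+-comm _ _)) (+-assoc _ _ _) ⟩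
        xᴱ ^ Q + (trace e x ^ Q + x)   ≈⟨ +-congˡ (trace-telescope e x) ⟩
        xᴱ ^ Q + (trace e x + xᴱ)       ≈⟨ +-comm _ _ ⟩
        trace e x + xᴱ + xᴱ ^ Q         ≈⟨ +-congˡ (^-assocʳ x (q ℕ.^ (e ℕ.* d)) Q) ⟩
        trace e x + xᴱ + x ^ (q ℕ.^ (e ℕ.* d) ℕ.* Q)     ≡⟨ ≡.cong (λ N → trace e x + xᴱ + x ^ N) (≡.trans (≡.sym (ℕ.^-distribˡ-+-* q (e ℕ.* d) d)) (≡.cong (q ℕ.^_) (ℕ.+-comm (e ℕ.* d) d))) ⟩
        trace e x + xᴱ + x ^ (q ℕ.^ (suc e ℕ.* d))       ∎
        where
        open ≈-Reasoning
        Q  = q ℕ.^ d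
        xᴱ = x ^ (q ℕ.^ (e ℕ.* d))

      trace-monic : ∀ e → Monic (q ℕ.^ (e ℕ.* d)) (trace (suc e))
      trace-monic zero    = monic-+ (degree<-zero _) (monic-^ _)
      trace-monic (suc e) = monic-+ (degree<-monic (ℕ.^-monoʳ-< q 1<q (ℕ.m<n+m (e ℕ.* d) d>0)) (trace-monic e)) (monic-^ _)

      module _ (e : ℕ) (m≡ : m ≡ suc e ℕ.* d) where

        tr : Carrier → Carrier
        tr = trace (suc e)

        -- For e + 1 = m / d the two ends of the telescope are x and x^(q^m), which agree by
        -- `fermat`.
        trace-fixed : ∀ x → tr x ^ (q ℕ.^ d) ≈ tr x
        trace-fixed x = +-cancelʳ x _ _ (trans (trace-telescope (suc e) x)
          (+-congˡ (trans (reflexive (≡.cong (λ r → x ^ (q ℕ.^ r)) (≡.sym m≡))) (fermat x))))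

        kernel : Subspace ℓ₁′
        kernel = record
          { member   = λ x → tr x ≈ 0#
          ; resp-≈   = λ x≈y → trans (trace-cong (suc e) (sym x≈y))
          ; 0-closed = trace-0 (suc e)
          ; +-closed = λ x∈ y∈ → trans (trace-+ (suc e) _ _) (trans (+-cong x∈ y∈) (+-identityˡ 0#))
          ; ·-closed = λ k x∈ → trans (trace-· (suc e) k _) (trans (·-congˡ k x∈) (·-zeroʳ k))
          }

        kernelSpace : Σ[ V ∈ Space ] Member V ≐ member kernel
        kernelSpace = toSpace kernel λ x → tr x ≟ 0#

        span-trace : ∀ (vs : Vec Carrier n) → Span (map tr vs) x → ∃[ y ] Span vs y × x ≈ tr y
        span-trace [] (nil x≈0) = 0# , nil refl , trans x≈0 (sym (trace-0 (suc e)))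
        span-trace (v ∷ vs) (cons k y∈ x≈) = let z , z∈ , y≈ = span-trace vs y∈ in
          k · v + z , cons k z∈ refl , trans x≈ (sym (trans (trace-+ (suc e) _ z) (+-cong (trace-· (suc e) k v) (sym y≈))))

        -- If tr v = tr y with y in the span of the later vectors, then v - y lies in the kernel,
        -- against independence modulo the kernel.
        trace-independent : ∀ (vs : Vec Carrier n) → Independent (vs ⧺ basis (proj₁ kernelSpace)) → Independent (map tr vs)
        trace-independent [] _ = []
        trace-independent (v ∷ vs) (v∉ ∷ vs-indep) = (λ tr-v∈ →
          let y , y∈ , tr-v≈ = span-trace vs tr-v∈
              tr[v-y]≈0 = trans (trace-+ (suc e) v (- y)) (trans (+-cong tr-v≈ (trans (trace-cong (suc e) (sym (-1· y)))
                (trans (trace-· (suc e) _ y) (-1· _)))) (-‿inverseʳ _))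
          in v∉ (span-resp (trans (+-comm y _) (x-y+y≈x v y)) (span-++⁺ y∈ (proj₂ (proj₂ kernelSpace) tr[v-y]≈0))))
          ∷ trace-independent vs vs-indep

        -- Rank–nullity for the trace L → H, whose kernel has dimension at most m - d
        -- because the trace is a monic polynomial of degree q^(m-d).
        d≤degree : d ≤ degree
        d≤degree with complete whole (λ _ → yes _) (basis-independent (proj₁ kernelSpace)) (λ _ → _)
        ... | s , X , spanning = ℕ.+-cancelʳ-≤ (e ℕ.* d) d degree (begin
          suc e ℕ.* d                           ≡⟨ m≡ ⟨
          m                                     ≤⟨ spanning⇒m≤ (λ _ → spanning _) ⟩
          s ℕ.+ dim (proj₁ kernelSpace)         ≤⟨ ℕ.+-mono-≤ s≤degree kernel≤ ⟩
          degree ℕ.+ e ℕ.* d                    ∎)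
          where
          open ℕ.≤-Reasoning
          s≤degree : s ≤ degree
          s≤degree = steinitz (trace-independent (new X) (independent X)) λ x∈ →
            let y , _ , x≈ = span-trace (new X) x∈ in span-resp (sym x≈) (fixed⁺ (trace-fixed y))
          kernel≤ : dim (proj₁ kernelSpace) ≤ e ℕ.* d
          kernel≤ = roots-dim (trace-monic e) (basis-independent (proj₁ kernelSpace)) (proj₁ (proj₂ kernelSpace))

  -- Construction of an unmatchable pair

  independent-tail : ∀ {v} {vs : Vec Carrier n} → Independent (v ∷ vs) → Independent vs
  independent-tail (_ ∷ vs-indep) = vs-indep

  independent-++ˡ : ∀ (us : Vec Carrier n) → Independent (us ⧺ vs) → Independent us
  independent-++ˡ []       _                  = []
  independent-++ˡ (u ∷ us) (u∉ ∷ us-indep) = (u∉ ∘ span-++ˡ) ∷ independent-++ˡ us us-indep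

  independent-++-disjoint : ∀ (us : Vec Carrier n) → Independent (us ⧺ vs) → Span us x → Span vs x → x ≈ 0#
  independent-++-disjoint [] _ (nil x≈0) _ = x≈0
  independent-++-disjoint {vs = vs} (u ∷ us) (u∉ ∷ us-indep) (cons k y∈ x≈) x∈vs = independent-++-disjoint us us-indep
    (span-resp (sym x≈y) y∈) x∈vs
    where
    k≈0 = ∉⇒scalar≈0 (span (us ⧺ vs)) u∉ (+-cancelʳ-∈ (span (us ⧺ vs)) (span-++ˡ y∈) (span-resp x≈ (span-++ʳ us x∈vs)))
    x≈y = trans x≈ (trans (+-congʳ (trans (·-congʳ k≈0) (·-zeroˡ u))) (+-identityˡ _))

  sum-++ : ∀ r {s} (f : Vector Carrier (r ℕ.+ s)) → sum f ≈ sum (λ i → f (i ↑ˡ s)) + sum (λ i → f (r ↑ʳ i))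
  sum-++ zero    f = sym (+-identityˡ _)
  sum-++ (suc r) f = trans (+-congˡ (sum-++ r (f ∘ suc))) (sym (+-assoc _ _ _))

  except⊆removeAt : ∀ (b : Vector Carrier (suc n)) i → ⟨ entriesExcept i b ⟩ ⊆ Span (tabulate (removeAt b i))
  except⊆removeAt b i = ⟨⟩⊆ (span (tabulate (removeAt b i))) {X = entriesExcept i b} λ { (j , j≢i , x≈bj) →
    span-resp (trans (reflexive (≡.cong b (Fin.punchIn-punchOut (j≢i ∘ ≡.sym)))) (sym x≈bj))
      (span-tabulate (removeAt b i) (punchOut (j≢i ∘ ≡.sym))) }

  linearlyIndependent⇒∉ : ∀ {b : Vector Carrier (suc n)} → LinearlyIndependent b → ∀ i → b i ∉ Span (tabulate (removeAt b i))
  linearlyIndependent⇒∉ {b = b} b-indep i bi∈ with span-tabulate-coefficients (removeAt b i) bi∈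
  ... | l , bi≈ = K.1≉0 (K.trans (K.sym (K.-‿involutive K.1#)) (K.trans (K.-‿cong
        (K.trans (K.sym (K.reflexive (insertAt-lookup l i (K.- K.1#)))) (b-indep coeffs lc≈0 i))) K.-0#≈0#))
    where
    coeffs = insertAt l i (K.- K.1#)
    lc≈0 : linearCombination coeffs b ≈ 0#
    lc≈0 = begin
      linearCombination coeffs b                                             ≈⟨ sum-remove {i = i} (λ j → coeffs j · b j) ⟩
      coeffs i · b i + linearCombination (removeAt coeffs i) (removeAt b i)       ≈⟨ +-cong (·-congʳ (K.reflexive (insertAt-lookup l i (K.- K.1#))))
                                                                             (linearCombination-cong (removeAt b i) (K.reflexive ∘ insertAt-punchIn l i (K.- K.1#))) ⟩
      (K.- K.1#) · b i + linearCombination l (removeAt b i)             ≈⟨ +-cong (-1· (b i)) (sym bi≈) ⟩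
      - b i + b i                                                       ≈⟨ -‿inverseˡ (b i) ⟩
      0#                                                                ∎
      where
      open ≈-Reasoning

  except-coordinate≈0 : ∀ {n} {b : Vector Carrier n} → LinearlyIndependent b → ∀ i k →
                        linearCombination k b ∈ ⟨ entriesExcept i b ⟩ → k i K.≈ K.0#
  except-coordinate≈0 {suc n} {b} b-indep i k lc∈ = ∉⇒scalar≈0 (span (tabulate (removeAt b i))) (linearlyIndependent⇒∉ {b = b} b-indep i)
    (+-cancelʳ-∈ (span (tabulate (removeAt b i))) (linearCombination-closed (span (tabulate (removeAt b i))) (removeAt k i) (removeAt b i) (span-tabulate (removeAt b i)))
      (span-resp (sum-remove {i = i} (λ j → k j · b j)) (except⊆removeAt b i lc∈)))

  module Unmatched (H : Subfield) where
    open Subfield H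

    -- The vectors hs complete 1# to a basis of H. Independence is restated with 1# in front, so
    -- that the space B can be built around hs and 1# dropped.
    hyperplane : ∃[ s ] degree ≤ s ℕ.+ 1 × Σ[ hs ∈ Vec Carrier s ] Independent (1# ∷ hs) × Span hs ⊆ Member space
    hyperplane with complete {vs = 1# ∷ []} (subspace space) (member? space) ((λ { (nil 1≈0) → 1≉0 1≈0 }) ∷ [])
                                 (span⊆ (subspace space) (1-closed ∷ []))
    ... | s , X , H⊆X = s , steinitz (basis-independent space) H⊆X , new X ,
          (λ 1∈ → 1≉0 (independent-++-disjoint (new X) (independent X) 1∈ (span-head []))) ∷ independent-++ˡ (new X) (independent X) ,
          contained X ∘ span-++ˡ

    -- New vectors are chosen independent of 1# and hs together, and 1# is then discarded. The
    -- discarded vector also takes up a dimension of L, hence the strict bound t + s < m.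
    avoiding-1 : ∀ {s} (hs : Vec Carrier s) → Independent (1# ∷ hs) → ∀ t → t ℕ.+ s < m →
                 Σ[ B ∈ Space ] dim B ≡ t ℕ.+ s × 1# ∉ Member B × Span hs ⊆ Member B
    avoiding-1 {s} hs hs-indep@(1∉hs ∷ _) t t+s<m with grow whole (λ _ → yes _) hs-indep (λ _ → _) t
    ... | inj₂ (t′ , t′<t , X , spanning) = contradiction (spanning⇒m≤ (λ _ → spanning _)) (ℕ.<⇒≱ (ℕ.≤-trans
            (s≤s (ℕ.≤-reflexive (ℕ.+-suc t′ s))) (ℕ.≤-trans (s≤s (ℕ.+-monoˡ-≤ s t′<t)) t+s<m)))
    ... | inj₁ X = record { basis = new X ⧺ hs ; basis-independent = independent-++ (new X) (independent X) (independent-tail hs-indep) (λ _ → span-∷⁺ 1#) } ,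
          ≡.refl , 1∉ , span-++ʳ (new X)
      where
      1∉ : 1# ∉ Span (new X ⧺ hs)
      1∉ 1∈ = let y , z , y∈ , z∈ , 1≈y+z = span-++⁻ (new X) 1∈
                  y∈′ = +-cancelʳ-∈ (span (1# ∷ hs)) (span-∷⁺ 1# z∈) (span-resp 1≈y+z (span-head hs))
                  y≈0 = independent-++-disjoint (new X) (independent X) y∈ y∈′
              in 1∉hs (span-resp (sym (trans 1≈y+z (trans (+-congʳ y≈0) (+-identityˡ z)))) z∈)

    -- Matching would make the coordinates of every h ∈ ⟨hs⟩ vanish at the basis
    -- vectors indexed by U, leaving only r coordinates.
    not-matchable : ∀ {r s} U → Stable U → (rest : Vec Carrier r) → (A-indep : Independent (rest ⧺ basis U)) →
                    (hs : Vec Carrier s) → Independent hs → Span hs ⊆ Member space →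
                    (B : Subspace (c ⊔ c′ ⊔ ℓ₁′)) → Span hs ⊆ member B → r < s → Unmatchable (r ℕ.+ dim U) (span (rest ⧺ basis U)) B
    not-matchable {r = r} {s} U U-stable rest A-indep hs hs-indep hs⊆H B hs⊆B r<s matching =
      ℕ.<⇒≱ r<s (steinitz hs-indep hs⊆first)
      where
      a = lookup (rest ⧺ basis U)
      matched = matching a (span-orderedBasis A-indep)
      b = proj₁ matched
      b-basis = proj₁ (proj₂ matched)
      -- The basis of A lists `rest` before the basis of U, so these are the positions at which hs
      -- imposes no condition.
      first : Vector Carrier r
      first i = b (i ↑ˡ dim U)
      a≡ : ∀ j → a (r ↑ʳ j) ≡ lookup (basis U) j
      a≡ = Vec.lookup-++ʳ rest (basis U)
      h∈except : ∀ {h} → Span hs h → ∀ j → h ∈ ⟨ entriesExcept (r ↑ʳ j) b ⟩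
      h∈except {h} h∈ j = let x = a (r ↑ʳ j)
                              x⁻¹ , x⁻¹x≈1 = inverse x≉0
        in proj₂ (proj₂ matched) (r ↑ʳ j)
          ((x⁻¹ , x⁻¹x≈1 , h * x , span-++ʳ rest (U-stable (hs⊆H h∈) (≡.subst (Member U) (≡.sym (a≡ j)) (span-lookup (basis U) j))) ,
            sym (trans (*-congˡ (*-comm h x)) (trans (sym (*-assoc x⁻¹ x h)) (trans (*-congʳ x⁻¹x≈1) (*-identityˡ h))))) , hs⊆B h∈)
        where
        lookup≉0 : ∀ {n} {vs : Vec Carrier n} → Independent vs → ∀ i → ¬ lookup vs i ≈ 0#
        lookup≉0 (v∉ ∷ _)    zero    v≈0 = v∉ (span-resp (sym v≈0) span-0)
        lookup≉0 (_ ∷ indep) (suc i) = lookup≉0 indep i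
        x≉0 : ¬ a (r ↑ʳ j) ≈ 0#
        x≉0 = lookup≉0 A-indep (r ↑ʳ j)
      hs⊆first : Span hs ⊆ Span (tabulate first)
      hs⊆first {h} h∈ with span-tabulate-coefficients b (proj₂ (orderedBasis⇒span B b-basis) (hs⊆B h∈))
      ... | k , h≈ = span-resp (sym (trans h≈ (trans (sum-++ r (λ i → k i · b i)) (trans (+-congˡ rest≈0) (+-identityʳ _)))))
              (linearCombination-closed (span (tabulate first)) (λ i → k (i ↑ˡ dim U)) first (span-tabulate first))
        where
        k≈0 : ∀ j → k (r ↑ʳ j) K.≈ K.0#
        k≈0 j = except-coordinate≈0 (proj₁ b-basis) (r ↑ʳ j) k
          (let o , v , l , v∈ , h≈lc = h∈except h∈ j in o , v , l , v∈ , trans (sym h≈) h≈lc)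
        rest≈0 : linearCombination (λ j → k (r ↑ʳ j)) (λ j → b (r ↑ʳ j)) ≈ 0#
        rest≈0 = trans (linearCombination-cong (λ j → b (r ↑ʳ j)) k≈0) (linearCombination-0 (λ j → b (r ↑ʳ j)))

    spaceDimension : ∀ V → dim V ≡ n → HasDimension (subspace V) n
    spaceDimension V ≡.refl = lookup (basis V) , span-orderedBasis (basis-independent V)

    UnmatchablePair : ℕ → Set (Level.suc (c ⊔ c′ ⊔ ℓ₁′) ⊔ ℓ₁)
    UnmatchablePair n = Σ[ A ∈ Subspace (c ⊔ c′ ⊔ ℓ₁′) ] Σ[ B ∈ Subspace (c ⊔ c′ ⊔ ℓ₁′) ]
      HasDimension A n × HasDimension B n × 1# ∉ member B × Unmatchable n A B

    stable-of-dimension : ∀ i → i ℕ.* degree < m → Σ[ U ∈ Space ] Stable U × dim U ≡ i ℕ.* degree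
    stable-of-dimension i ih<m with stable-chain wholeSpace (λ _ _ → ∈-whole) i
    ... | inj₁ (U , _ , U-stable , dimU≡) = U , U-stable , dimU≡
    -- Early exhaustion of L would give m = j * degree ≤ i * degree < m.
    ... | inj₂ (j , j<i , dim≡) = contradiction ih<m (ℕ.≤⇒≯ (ℕ.≤-trans (ℕ.≤-reflexive (≡.trans (≡.sym dim-whole) dim≡))
            (ℕ.*-monoˡ-≤ degree (ℕ.<⇒≤ j<i))))

    extend : ∀ U r → r ℕ.+ dim U < m → Extension whole (basis U) r
    extend U r r+u<m with grow whole (λ _ → yes _) (basis-independent U) (λ _ → _) r
    ... | inj₁ X = X
    ... | inj₂ (s , s<r , X , spanning) = contradiction (ℕ.≤-trans (spanning⇒m≤ (λ _ → spanning _))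
            (ℕ.+-monoˡ-≤ (dim U) (ℕ.<⇒≤ s<r))) (ℕ.<⇒≱ r+u<m)

    unmatchable-pair-at : ∀ {n r} U → Stable U → r ℕ.+ dim U ≡ n → suc r < degree → degree ≤ n → n < m → UnmatchablePair n
    unmatchable-pair-at {n} {r} U U-stable r+u≡n 1+r<degree degree≤n n<m =
      subspace A , subspace B , spaceDimension A r+u≡n , spaceDimension B (≡.trans dimB≡ (ℕ.m∸n+n≡m size≤n)) , 1∉B ,
      ≡.subst (λ n → Unmatchable n (subspace A) (subspace B)) r+u≡n
        (not-matchable U U-stable (new X) (independent X) hs hs-independent hs⊆H (subspace B) hs⊆B r<size)
      where
      X = extend U r (≡.subst (_< m) (≡.sym r+u≡n) n<m)
      A : Space
      A = record { basis = new X ⧺ basis U ; basis-independent = independent X }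
      size : ℕ
      size = proj₁ hyperplane
      degree≤size+1 = proj₁ (proj₂ hyperplane)
      hs : Vec Carrier size
      hs = proj₁ (proj₂ (proj₂ hyperplane))
      1∷hs-independent : Independent (1# ∷ hs)
      1∷hs-independent = proj₁ (proj₂ (proj₂ (proj₂ hyperplane)))
      hs⊆H : Span hs ⊆ Member space
      hs⊆H = proj₂ (proj₂ (proj₂ (proj₂ hyperplane)))
      hs-independent : Independent hs
      hs-independent = independent-tail 1∷hs-independent
      size≤n : size ≤ n
      size≤n = ℕ.≤-trans (steinitz hs-independent hs⊆H) degree≤n
      r<size : r < size
      r<size = ℕ.≤-pred (ℕ.≤-trans 1+r<degree (ℕ.≤-trans degree≤size+1 (ℕ.≤-reflexive (ℕ.+-comm size 1))))
      B∃ = avoiding-1 hs 1∷hs-independent (n ℕ.∸ size) (≡.subst (_< m) (≡.sym (ℕ.m∸n+n≡m size≤n)) n<m)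
      B = proj₁ B∃
      dimB≡ = proj₁ (proj₂ B∃)
      1∉B = proj₁ (proj₂ (proj₂ B∃))
      hs⊆B : Span hs ⊆ Member B
      hs⊆B = proj₂ (proj₂ (proj₂ B∃))

    unmatchable-pair : ∀ {n} → degree ≤ n → n < m → degree ∤ (n ℕ.+ 1) → UnmatchablePair n
    unmatchable-pair {n} degree≤n n<m degree∤n+1 =
      let U , U-stable , dimU≡ = stable-of-dimension quotient (ℕ.≤-trans (s≤s quotient*degree≤n) n<m) in
      unmatchable-pair-at U U-stable (≡.trans (≡.cong (remainder ℕ.+_) dimU≡) (≡.sym n≡)) 1+r<degree degree≤n n<m
      where
      instance _ = ℕ.>-nonZero degree>0
      quotient  = n / degree
      remainder = n % degree
      n≡ : n ≡ remainder ℕ.+ quotient ℕ.* degree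
      n≡ = m≡m%n+[m/n]*n n degree
      quotient*degree≤n : quotient ℕ.* degree ≤ n
      quotient*degree≤n = ℕ.≤-trans (ℕ.m≤n+m _ remainder) (ℕ.≤-reflexive (≡.sym n≡))
      1+r<degree : suc remainder < degree
      -- A remainder of degree - 1 would make n + 1 equal to (quotient + 1) * degree.
      1+r<degree = ℕ.≤∧≢⇒< (m%n<n n degree) λ 1+r≡degree → degree∤n+1 (divides (suc quotient)
        (≡.trans (ℕ.+-comm n 1) (≡.trans (≡.cong suc n≡) (≡.cong (ℕ._+ quotient ℕ.* degree) 1+r≡degree))))

  -- `Unmatchable` is a negation, so the divisor is obtained from it by contradiction, and this
  -- takes a decidable existence statement.
  smallNondivisor? : ∀ n → Dec (SmallNondivisor n)
  smallNondivisor? n = map′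
    (λ (d , d<1+n , 0<d , d∣m , d∤n+1) → d , 0<d , d∣m , ℕ.≤-pred d<1+n , d∤n+1)
    (λ (d , 0<d , d∣m , d≤n , d∤n+1) → d , s≤s d≤n , 0<d , d∣m , d∤n+1)
    (ℕ.anyUpTo? (λ d → 0 ℕ.<? d ×-dec d ∣? m ×-dec ¬? (d ∣? (n ℕ.+ 1))) (suc n))

  subfield : PrimePower q → 0 < m → ∀ {d} → 0 < d → d ∣ m → Σ[ H ∈ Subfield ] Subfield.degree H ≡ d
  subfield _ 0<m _ (divides zero m≡0) = contradiction (≡.subst (0 <_) m≡0 0<m) ℕ.n≮0
  -- The quotient m / d is suc e, the number of summands of the trace.
  subfield (ch , j , ch-prime , _ , q≡) _ {d} d>0 (divides (suc e) m≡) =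
    fixedField , ℕ.≤-antisym degree≤d (d≤degree e m≡)
    where
    open FrobeniusPower {j = j} ch-prime q≡
    open FixedField d d>0

open import Data.Nat.Base using (_+_; _^_)

corollary3p12 : ∀ {c ℓ₁ ℓ₂ c′ ℓ₁′ ℓ₂′ : Level}
    {K : HeytingField c ℓ₁ ℓ₂} {L : HeytingField c′ ℓ₁′ ℓ₂′}
    (E : ProperFieldExtension K L)
    (q m t n : ℕ) →
    PrimePower q →
    Composite m →
    HasCardinality K q →
    HasCardinality L (q ^ m) →
    SmallestPrimeDivisor t m →
    t ≤ n →
    n < m →
    let open LinearMatching E in
    (Σ[ A ∈ Subspace (c ⊔ c′ ⊔ ℓ₁′) ] Σ[ B ∈ Subspace (c ⊔ c′ ⊔ ℓ₁′) ]
    HasDimension A n × HasDimension B n ×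
    HeytingField.1# L ∉ member B × Unmatchable n A B)
    ⇔
    (∃[ d ] 0 < d × d ∣ m × d ≤ n × d ∤ (n + 1))
corollary3p12 E q m t n primePower _ card-K card-L _ _ n<m = mk⇔
  (λ (A , B , _ , B-dim , 1∉B , unmatchable) → decidable-stable (smallNondivisor? n) λ no-divisor →
    unmatchable (matchable A B B-dim 1∉B no-divisor))
  (λ (d , 0<d , d∣m , d≤n , d∤n+1) →
    let H , degree≡d = subfield primePower (ℕ.≤-<-trans ℕ.z≤n n<m) 0<d d∣m in
    Unmatched.unmatchable-pair H (≡.subst (_≤ n) (≡.sym degree≡d) d≤n) n<m
      (≡.subst (_∤ (n + 1)) (≡.sym degree≡d) d∤n+1))
  where
  open LinearAlgebra E {q} {m} card-K card-L
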